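{- Let $n$ be a positive integer, let $R$ be a simply connected region, and let $v_0$ be a vertex on the boundary of $R$. The map $\alpha\mapsto h_\alpha$ is a one-to-one correspondence between the order-$n$ ribbon tilings $\alpha$ of $R$ and the functions $h$ from the vertices of $R$ to $\mathbb Z^n$ satisfying the following three conditions, where $e_{0,1},e_{1,2},\dots,e_{n-1,0}$ denotes the standard basis of $\mathbb Z^n$: (1) $h(v_0)=0$; (2) if $(v,w)$ is an oriented boundary edge of $R$ of type $(i,i+1)$ with its square of color $i+1$ (the higher-level one) on the left, then $h(w)-h(v)=e_{i,i+1}$; (3) if $(v,w)$ is an oriented interior edge of $R$ of type $(i,i+1)$ with its square of color $i+1$ (the higher-level one) on the left, then $h(w)-h(v)\in\{e_{i,i+1}\}\cup\{2e_{j,j+1}-e_{i,i+1} : j\in\mathbb Z/n\mathbb Z,\ j\ne i\}$.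
   Context: Squares of the grid $\mathbb Z^2$ are indexed by integer pairs; $s_{x,y}$ is the unit square at position $(x,y)$. Two squares are adjacent if they share an edge. The square $s_{x,y}$ has level $x+y$ and color $x+y\bmod n$; colors are added modulo $n$. A ribbon tile of order $n$ is a connected set of squares containing exactly one square of each of the $n$ colors. A tile has type $(j,j+1)$ if its lowest-level square has color $j+1$ and its highest-level square has color $j$. Each edge of the grid separates a square of some level $c$ from one of level $c+1$; it has type $(i,i+1)$ if the lower-level square has color $i$ and the higher-level square has color $i+1$. A region is a finite set $R$ of squares that is connected via adjacency. It is simply connected if, for every square $s\notin R$, there is no connected cycle of squares in $R$ that encircles $s$ with a non-zero winding number. Vertices of $R$ are the corners of its squares. An edge is an interior edge of $R$ if both squares it separates are in $R$, and a boundary edge of $R$ if exactly one is; a boundary vertex is an endpoint of a boundary edge. An order-$n$ ribbon tiling of $R$ is a partition of $R$ into ribbon tiles of order $n$. An edge crosses a tile $t$ if both squares it separates belong to $t$. For an order-$n$ ribbon tiling $\alpha$ of $R$, the height function $h_\alpha$ from the vertices of $R$ to $\mathbb Z^n$ is described by the following rules: $h_\alpha(v_0)=0$ and, when moving from $v$ to $w$ along an edge of type $(i,i+1)$ incident to a square of $R$, with the square of color $i+1$ (the higher-level square) on the left, $h_\alpha(w)-h_\alpha(v)=e_{i,i+1}$ if the edge crosses no tile of $\alpha$, and $h_\alpha(w)-h_\alpha(v)=2e_{j,j+1}-e_{i,i+1}$ if the edge crosses a tile of $\alpha$ of type $(j,j+1)$.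
   Formalization: Vertices of R are corners of its squares glued along common edges, so a point where R has just two diagonally opposite squares counts as two vertices; with lattice points as vertices the claim fails for some such regions (n = 2). Regions without such points are unaffected. -}

module Defs where

open import Level using (0ℓ)
open import Data.Bool.Base using (if_then_else_; _∧_)
open import Data.Nat.Base as ℕ using (ℕ; NonZero)
open import Data.Nat.DivMod using (_mod_)
open import Data.Integer.Base using (ℤ; 0ℤ; 1ℤ; _+_; _-_; _*_; +_; -_; _≤_)
open import Data.Integer.Properties using (_≟_; _<?_)
open import Data.Integer.DivMod using (_%ℕ_; n%ℕd<d)
open import Data.Fin.Base using (Fin; fromℕ<; toℕ)
import Data.Fin.Properties as Fin
open import Data.List.Base using (List)
open import Data.List.Membership.Propositional using (_∈_; _∉_)
import Data.List.Membership.Setoid as SetoidMembership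
import Data.List.Relation.Binary.Subset.Propositional as Subset
import Data.List.Relation.Binary.Subset.Setoid as SetoidSubset
open import Data.Product.Base using (Σ; Σ-syntax; ∃; ∃-syntax; _×_; _,_; proj₁; proj₂; swap)
open import Data.Product using (∃!)
open import Data.Sum.Base as Sum using (_⊎_)
open import Data.Vec.Functional using (Vector; zipWith; map; replicate)
import Data.Vec.Functional.Relation.Binary.Equality.Setoid as VecEquality
open import Function.Bundles using (Func; _⟨$⟩_)
open import Function.Relation.Binary.Setoid.Equality using () renaming (setoid to _⇨_)
open import Relation.Binary.Bundles using (Setoid)
open import Relation.Binary.Construct.Closure.ReflexiveTransitive using (Star; ε; _◅_; _◅◅_; reverse)
import Relation.Binary.Construct.On as On
open import Relation.Binary.PropositionalEquality using (_≡_; _≢_; refl)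
import Relation.Binary.PropositionalEquality.Properties as ≡
open import Relation.Nullary using (¬_; does)
open import Relation.Unary using (Pred)

------------------------------------------------------------------------
-- The grid

-- (x , y) denotes the unit square [x , x + 1] × [y , y + 1].
Square : Set
Square = ℤ × ℤ

Point : Set
Point = ℤ × ℤ

level : Square → ℤ
level (x , y) = x + y

data Direction : Set where
  east north west south : Direction

-- A unit edge of the grid, oriented: it leaves its tail in the given direction.
OrientedEdge : Set
OrientedEdge = Point × Direction

tail head : OrientedEdge → Point
tail (p , _) = p
head ((x , y) , east)  = x + 1ℤ , y
head ((x , y) , north) = x , y + 1ℤ
head ((x , y) , west)  = x - 1ℤ , y
head ((x , y) , south) = x , y - 1ℤ

-- The squares on the two sides of an oriented edge.
left right : OrientedEdge → Square
left ((x , y) , east)  = x , y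
left ((x , y) , north) = x - 1ℤ , y
left ((x , y) , west)  = x - 1ℤ , y - 1ℤ
left ((x , y) , south) = x , y - 1ℤ
right ((x , y) , east)  = x , y - 1ℤ
right ((x , y) , north) = x , y
right ((x , y) , west)  = x - 1ℤ , y
right ((x , y) , south) = x - 1ℤ , y - 1ℤ

Adjacent : Square → Square → Set
Adjacent s t = ∃[ e ] (left e ≡ s × right e ≡ t ⊎ left e ≡ t × right e ≡ s)

IsCorner : Point → Square → Set
IsCorner (p , q) (x , y) = (p ≡ x ⊎ p ≡ x + 1ℤ) × (q ≡ y ⊎ q ≡ y + 1ℤ)

------------------------------------------------------------------------
-- Connectedness and simple connectedness of sets of squares

Walk : Pred Square 0ℓ → Square → Square → Set
Walk P = Star (λ s t → P s × P t × Adjacent s t)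

Walk-sym : ∀ {P s t} → Walk P s t → Walk P t s
Walk-sym = reverse λ { (Ps , Pt , e , sides) → Pt , Ps , e , Sum.swap sides }

-- A list of squares stands for the finite set of its members.
Connected : List Square → Set
Connected R = ∀ {s t} → s ∈ R → t ∈ R → Walk (_∈ R) s t

-- The winding number of a closed walk around the square c, a square not on the
-- walk, is the signed number of times the walk (through the centres of its
-- squares) crosses, counterclockwise, the ray that leaves the centre of c
-- eastwards, turned up by an infinitesimal angle.  The ray is crossed by the
-- steps between row b and row b + 1 in the columns x > a.
crossing : Square → Square → Square → ℤ
crossing (a , b) (x , y) (x′ , y′) =
  if does (a <? x)
  then (if does (y ≟ b) ∧ does (y′ ≟ b + 1ℤ) then 1ℤ else
        if does (y ≟ b + 1ℤ) ∧ does (y′ ≟ b) then - 1ℤ else 0ℤ)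
  else 0ℤ

winding : ∀ {P s t} → Square → Walk P s t → ℤ
winding c ε = 0ℤ
winding c (_◅_ {i = s} {j = t} _ γ) = crossing c s t + winding c γ

SimplyConnected : List Square → Set
SimplyConnected R =
  ∀ {c} → c ∉ R → ¬ (∃[ s ] Σ[ γ ∈ Walk (_∈ R) s s ] winding c γ ≢ 0ℤ)

------------------------------------------------------------------------
-- Vertices and edges of a region

record Vertex (R : List Square) : Set where
  field
    square   : Square
    square∈R : square ∈ R
    point    : Point
    isCorner : IsCorner point square

open Vertex public

-- The vertices of R are the corners of its squares, corners being identified
-- when the squares are glued along their common edges: two corners are the same
-- vertex if they are the same point p and their squares are joined by a walk in
-- R around p.  This is plain equality of points, except where p has exactly two
-- squares of R around it and these are diagonally opposite.  Such a pinch point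
-- counts as two vertices.  It is compatible with SimplyConnected, whose walks go
-- through edges: the eight squares around a square s, less one of the four that
-- touch s only at a corner, are simply connected and pinched at that corner.
-- With a single vertex there, the boundary edges around s (of colour i) would
-- force 2e_{i-1,i} = 2e_{i,i+1}, and no height function would exist for n > 1.
SameVertex : (R : List Square) → Vertex R → Vertex R → Set
SameVertex R v w =
  point v ≡ point w × Walk (λ s → s ∈ R × IsCorner (point v) s) (square v) (square w)

vertexSetoid : List Square → Setoid 0ℓ 0ℓ
vertexSetoid R = record
  { Carrier = Vertex R
  ; _≈_ = SameVertex R
  ; isEquivalence = record
    { refl  = refl , ε
    ; sym   = λ { {record {}} {record {}} (refl , γ) → refl , Walk-sym γ }
    ; trans = λ { {record {}} {record {}} {record {}} (refl , γ) (refl , δ) → refl , γ ◅◅ δ }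
    }
  }

module _ (R : List Square) where

  -- e is an edge from v to w incident to a square of R.
  record EdgeFromTo (e : OrientedEdge) (v w : Vertex R) : Set where
    field
      sameSquare : square v ≡ square w
      incident   : square v ≡ left e ⊎ square v ≡ right e
      from       : point v ≡ tail e
      to         : point w ≡ head e

  Interior Boundary : OrientedEdge → Set
  Interior e = left e ∈ R × right e ∈ R
  Boundary e = (left e ∈ R × right e ∉ R) ⊎ (left e ∉ R × right e ∈ R)

  BoundaryVertex : Vertex R → Set
  BoundaryVertex v₀ =
    ∃[ e ] ∃[ v ] ∃[ w ] Boundary e × EdgeFromTo e v w × (SameVertex R v₀ v ⊎ SameVertex R v₀ w)

------------------------------------------------------------------------
-- Colours, ribbon tiles and tilings

module _ (n : ℕ) .{{_ : NonZero n}} where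

  -- Colours, i.e. integers modulo n.
  colour : Square → Fin n
  colour s = fromℕ< (n%ℕd<d (level s) n)

  next : Fin n → Fin n
  next i = ℕ.suc (toℕ i) mod n

  -- e has type (i , i + 1), with its higher-level square on the left.
  record EdgeOfType (i : Fin n) (e : OrientedEdge) : Set where
    field
      higherOnLeft : level (left e) ≡ level (right e) + 1ℤ
      lowerColour  : colour (right e) ≡ i
      higherColour : colour (left e) ≡ next i

  record Tile : Set where
    field
      squares   : List Square
      connected : Connected squares
      colours   : ∀ c → ∃! _≡_ λ s → s ∈ squares × colour s ≡ c

  open Tile

  tileSetoid : Setoid 0ℓ 0ℓ
  tileSetoid = record
    { Carrier = Tile
    ; _≈_ = λ t u → squares t Subset.⊆ squares u × squares u Subset.⊆ squares t
    ; isEquivalence = record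
      { refl  = (λ s∈t → s∈t) , (λ s∈t → s∈t)
      ; sym   = swap
      ; trans = λ (t⊆u , u⊆t) (u⊆v , v⊆u) → (λ s∈t → u⊆v (t⊆u s∈t)) , (λ s∈v → u⊆t (v⊆u s∈v))
      }
    }

  open Setoid tileSetoid using () renaming (_≈_ to _≈ₜ_)
  open SetoidMembership tileSetoid using () renaming (_∈_ to _∈ₜ_)
  open SetoidSubset tileSetoid using () renaming (_⊆_ to _⊆ₜ_)

  -- t has type (j , j + 1).
  record TileOfType (j : Fin n) (t : Tile) : Set where
    field
      lowest highest : Square
      lowest∈t       : lowest ∈ squares t
      highest∈t      : highest ∈ squares t
      isLowest       : ∀ {s} → s ∈ squares t → level lowest ≤ level s
      isHighest      : ∀ {s} → s ∈ squares t → level s ≤ level highest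
      lowestColour   : colour lowest ≡ next j
      highestColour  : colour highest ≡ j

  Crosses : OrientedEdge → Tile → Set
  Crosses e t = left e ∈ squares t × right e ∈ squares t

  record Tiling (R : List Square) : Set where
    field
      tiles    : List Tile
      within   : ∀ {t s} → t ∈ₜ tiles → s ∈ squares t → s ∈ R
      covering : ∀ {s} → s ∈ R → ∃[ t ] t ∈ₜ tiles × s ∈ squares t
      disjoint : ∀ {t u s} → t ∈ₜ tiles → u ∈ₜ tiles → s ∈ squares t → s ∈ squares u → t ≈ₜ u

  open Tiling

  tilingSetoid : List Square → Setoid 0ℓ 0ℓ
  tilingSetoid R = record
    { Carrier = Tiling R
    ; _≈_ = λ α β → tiles α ⊆ₜ tiles β × tiles β ⊆ₜ tiles α
    ; isEquivalence = record
      { refl  = (λ t∈α → t∈α) , (λ t∈α → t∈α)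
      ; sym   = swap
      ; trans = λ (α⊆β , β⊆α) (β⊆γ , γ⊆β) → (λ {t} t∈α → β⊆γ {t} (α⊆β {t} t∈α)) , (λ {t} t∈γ → β⊆α {t} (γ⊆β {t} t∈γ))
      }
    }

------------------------------------------------------------------------
-- Height functions

  open VecEquality (≡.setoid ℤ) using (_≋_; ≋-setoid)

  infixl 6 _⊖_
  _⊖_ : Vector ℤ n → Vector ℤ n → Vector ℤ n
  _⊖_ = zipWith _-_

  -- basis i is e_{i,i+1}.
  basis : Fin n → Vector ℤ n
  basis i k = if does (i Fin.≟ k) then 1ℤ else 0ℤ

  -- 2e_{j,j+1} - e_{i,i+1}
  crossed : Fin n → Fin n → Vector ℤ n
  crossed j i = map (+ 2 *_) (basis j) ⊖ basis i

  module _ (R : List Square) where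

    vertexFunctions : Setoid 0ℓ 0ℓ
    vertexFunctions = vertexSetoid R ⇨ ≋-setoid n

    VertexFunction : Set
    VertexFunction = Setoid.Carrier vertexFunctions

    -- The rules describing h_α.
    record IsHeightFunction (v₀ : Vertex R) (α : Tiling R) (h : VertexFunction) : Set where
      field
        base        : h ⟨$⟩ v₀ ≋ replicate n 0ℤ
        uncrossed   : ∀ {e v w i} → EdgeFromTo R e v w → EdgeOfType i e →
                      (∀ {t} → t ∈ₜ tiles α → ¬ Crosses e t) →
                      (h ⟨$⟩ w) ⊖ (h ⟨$⟩ v) ≋ basis i
        crossesTile : ∀ {e v w i t j} → EdgeFromTo R e v w → EdgeOfType i e →
                      t ∈ₜ tiles α → Crosses e t → TileOfType j t →
                      (h ⟨$⟩ w) ⊖ (h ⟨$⟩ v) ≋ crossed j i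

    -- Conditions (1), (2), (3).
    record Admissible (v₀ : Vertex R) (h : VertexFunction) : Set where
      field
        base     : h ⟨$⟩ v₀ ≋ replicate n 0ℤ
        boundary : ∀ {e v w i} → EdgeFromTo R e v w → EdgeOfType i e → Boundary R e →
                   (h ⟨$⟩ w) ⊖ (h ⟨$⟩ v) ≋ basis i
        interior : ∀ {e v w i} → EdgeFromTo R e v w → EdgeOfType i e → Interior R e →
                   (h ⟨$⟩ w) ⊖ (h ⟨$⟩ v) ≋ basis i ⊎
                   (∃[ j ] j ≢ i × (h ⟨$⟩ w) ⊖ (h ⟨$⟩ v) ≋ crossed j i)

    admissibleSetoid : Vertex R → Setoid 0ℓ 0ℓ
    admissibleSetoid v₀ =
      On.setoid {B = Σ VertexFunction (Admissible v₀)} vertexFunctions proj₁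

{-# OPTIONS --safe #-}
module Submission where

-- Around a square of a tile of type (j , j + 1), the prescribed increments along the two lower edges
-- add up to 2e_j, and so do those along the two upper edges, whether or not the tile continues on
-- that side.  Hence the increments form a 1-form with zero curl on every square of R.  By a discrete
-- Stokes formula its integral along a closed walk is Σ_c (winding number around c) · (curl at c),
-- which vanishes since R is simply connected, so h_α exists; it is unique because R is connected.
-- As 2e_j - e_i ≠ e_i, the function h_α shows which edges are crossed, and the tiles are the
-- components of the crossed adjacencies.  Conversely, given h, the increments along the lower and
-- upper edges of a square have equal sums.  Comparing coordinates, at most one edge of each pair is
-- marked (has an increment 2e_j - e_i), both sums equal 2e_j for one j, a lower edge is marked
-- unless the square has colour j + 1, and an upper edge is marked unless it has colour j.  Thus
-- marked edges join the squares into paths that climb through the colours j + 1, …, j: the tiles.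

open import Defs
import Algebra.Properties.AbelianGroup as AbelianGroup
open import Data.Bool.Base using (true; false; if_then_else_; _∧_)
open import Data.Empty using (⊥; ⊥-elim)
open import Data.Fin.Base using (Fin; toℕ; fromℕ<)
import Data.Fin.Properties as Fin
open import Data.Integer.Base using (ℤ; 0ℤ; 1ℤ; -1ℤ; _+_; _-_; _*_; +_; -_; -[1+_]; _<_; _≤_; +<+; +≤+; ∣_∣)
open import Data.Integer.DivMod using (_%ℕ_; _/ℕ_; n%ℕd<d; a≡a%ℕn+[a/ℕn]*n)
import Data.Integer.Properties as ℤ
open import Data.Integer.Properties using (_≟_; _<?_; _≤?_)
open import Data.Integer.Tactic.RingSolver using (solve-∀)
open import Data.List.Base using (List; []; _∷_; applyUpTo)
import Data.List.Extrema as Extrema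
import Data.List.Membership.DecPropositional as DecMembership
open import Data.List.Membership.Propositional using (_∈_; _∉_; find; mapWith∈)
open import Data.List.Membership.Propositional.Properties using (∈-applyUpTo⁺; ∈-applyUpTo⁻)
import Data.List.Membership.Setoid as SetoidMembership
import Data.List.Relation.Unary.All as All
open import Data.List.Relation.Unary.Any as Any using (here; there)
open import Data.List.Relation.Unary.Any.Properties using (mapWith∈⁺; mapWith∈⁻)
open import Data.Nat.Base as ℕ using (ℕ; zero; suc; NonZero)
import Data.Nat.DivMod as ℕ
import Data.Nat.Properties as ℕ
open import Data.Product.Base using (Σ-syntax; ∃; ∃-syntax; _×_; _,_; proj₁; proj₂)
import Data.Product.Properties as Product
open import Data.Sum.Base as Sum using (_⊎_; inj₁; inj₂)
open import Data.Vec.Functional using (Vector)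
open import Function.Bundles using (Func; _⟨$⟩_; Bijection; _⇔_; mk⇔)
open import Relation.Binary.Bundles using (Setoid)
open import Relation.Binary.Construct.Closure.ReflexiveTransitive using (ε; _◅_; _◅◅_)
open import Relation.Binary.Definitions using (DecidableEquality)
open import Relation.Binary.PropositionalEquality
open import Relation.Nullary using (¬_; Dec; yes; no; does; contradiction)
open import Relation.Nullary.Decidable using (decidable-stable; _×-dec_)

open AbelianGroup ℤ.+-0-abelianGroup using () renaming (∙-cancelˡ to +-cancelˡ; ∙-cancelʳ to +-cancelʳ)

-- Connectedness and simple connectedness speak of walks through squares, whereas heights live on
-- vertices, and a pinch point carries two vertices. A path of grid points does not tell these two
-- apart, so the 1-form is integrated along walks of squares instead: each step is read as a unit
-- step between south-west corners, which runs along an edge of one of the two squares, and a last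
-- leg leads from the south-west corner of the final square to the vertex. Independence of the
-- square that represents a vertex is a separate local statement: only squares of `R` around the
-- same point are compared, and there the curl vanishes. Outside `R` the form has arbitrary values
-- and its curl is unknown. The Stokes formula is therefore proved for arbitrary forms on the grid,
-- over a box that contains `R`.

_≟ₛ_ : DecidableEquality Square
_≟ₛ_ = Product.≡-dec _≟_ _≟_

open DecMembership _≟ₛ_ using (_∈?_)

+1-1 : ∀ z → z + 1ℤ - 1ℤ ≡ z
+1-1 = solve-∀

-1+1 : ∀ z → z - 1ℤ + 1ℤ ≡ z
-1+1 = solve-∀

≢+1 : ∀ z → z ≢ z + 1ℤ
≢+1 z eq = contradiction (trans (sym (ℤ.+-inverseʳ z)) (trans (cong (_- z) eq) (lem z))) λ ()
  where
  lem : ∀ z → z + 1ℤ - z ≡ 1ℤ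
  lem = solve-∀

≢+2 : ∀ z → z ≢ z + 1ℤ + 1ℤ
≢+2 z eq = contradiction (trans (sym (ℤ.+-inverseʳ z)) (trans (cong (_- z) eq) (lem z))) λ ()
  where
  lem : ∀ z → z + 1ℤ + 1ℤ - z ≡ + 2
  lem = solve-∀

+1-injective : ∀ {x y} → x + 1ℤ ≡ y + 1ℤ → x ≡ y
+1-injective = +-cancelʳ 1ℤ _ _

-- Finite sums

∑ : ℕ → (ℕ → ℤ) → ℤ
∑ zero    f = 0ℤ
∑ (suc m) f = ∑ m f + f m

∑-cong : ∀ m {f g} → (∀ i → f i ≡ g i) → ∑ m f ≡ ∑ m g
∑-cong zero    f≗g = refl
∑-cong (suc m) f≗g = cong₂ _+_ (∑-cong m f≗g) (f≗g m)

∑-zero : ∀ m {f} → (∀ {i} → i ℕ.< m → f i ≡ 0ℤ) → ∑ m f ≡ 0ℤ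
∑-zero zero    f≗0 = refl
∑-zero (suc m) f≗0 = cong₂ _+_ (∑-zero m (λ i<m → f≗0 (ℕ.m<n⇒m<1+n i<m))) (f≗0 ℕ.≤-refl)

∑-+ : ∀ m f g → ∑ m (λ i → f i + g i) ≡ ∑ m f + ∑ m g
∑-+ zero    f g = refl
∑-+ (suc m) f g = trans (cong (_+ (f m + g m)) (∑-+ m f g)) (interchange (∑ m f) (∑ m g) (f m) (g m))
  where
  interchange : ∀ a b c d → a + b + (c + d) ≡ a + c + (b + d)
  interchange = solve-∀

∑-neg : ∀ m f → ∑ m (λ i → - f i) ≡ - ∑ m f
∑-neg zero    f = refl
∑-neg (suc m) f = trans (cong (_- f m) (∑-neg m f)) (sym (ℤ.neg-distrib-+ (∑ m f) (f m)))

∑-single : ∀ {m k f} → k ℕ.< m → (∀ {i} → i ≢ k → f i ≡ 0ℤ) → ∑ m f ≡ f k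
∑-single {suc m} {k} {f} k<1+m f≗0 with k ℕ.≟ m
... | yes refl = trans (cong (_+ f m) (∑-zero m (λ i<m → f≗0 (ℕ.<⇒≢ i<m)))) (ℤ.+-identityˡ _)
... | no  k≢m  = trans (cong₂ _+_ (∑-single (ℕ.≤∧≢⇒< (ℕ.≤-pred k<1+m) k≢m) f≗0) (f≗0 (≢-sym k≢m)))
                       (ℤ.+-identityʳ _)

∑-telescope : ∀ {m k f} (F : ℕ → ℤ) → k ℕ.≤ m →
              (∀ {i} → i ℕ.< k → f i ≡ F (suc i) - F i) →
              (∀ {i} → k ℕ.≤ i → f i ≡ 0ℤ) →
              ∑ m f ≡ F k - F 0
∑-telescope {zero}  {zero} F k≤m below above = sym (ℤ.+-inverseʳ (F 0))
∑-telescope {suc m} {k} {f} F k≤m below above with ℕ.m≤n⇒m<n∨m≡n k≤m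
... | inj₁ k<1+m = trans (cong₂ _+_ (∑-telescope F (ℕ.≤-pred k<1+m) below above) (above (ℕ.≤-pred k<1+m)))
                         (ℤ.+-identityʳ _)
... | inj₂ refl  = trans (cong₂ _+_ (full m (λ i<m → below (ℕ.m<n⇒m<1+n i<m))) (below ℕ.≤-refl))
                         (chain (F (suc m)) (F m) (F 0))
  where
  chain : ∀ a b c → b - c + (a - b) ≡ a - c
  chain = solve-∀
  full : ∀ l → (∀ {i} → i ℕ.< l → f i ≡ F (suc i) - F i) → ∑ l f ≡ F l - F 0
  full zero    _ = sym (ℤ.+-inverseʳ (F 0))
  full (suc l) b = trans (cong₂ _+_ (full l (λ i<l → b (ℕ.m<n⇒m<1+n i<l))) (b ℕ.≤-refl))
                         (chain (F (suc l)) (F l) (F 0))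

-- Indefinite sums over the integers

-- Normalised to vanish at 0 and continued to negative arguments so that `antidifference-+1` holds
-- at every integer.
antidifference : (ℤ → ℤ) → ℤ → ℤ
antidifference f (+ zero)        = 0ℤ
antidifference f (+ suc k)       = antidifference f (+ k) + f (+ k)
antidifference f -[1+ zero ]     = - f -[1+ 0 ]
antidifference f -[1+ suc k ]    = antidifference f -[1+ k ] - f -[1+ suc k ]

antidifference-+1 : ∀ f z → antidifference f (z + 1ℤ) ≡ antidifference f z + f z
antidifference-+1 f (+ k) rewrite ℕ.+-comm k 1 = refl
antidifference-+1 f -[1+ zero ]  = sym (ℤ.+-inverseˡ (f -[1+ 0 ]))
antidifference-+1 f -[1+ suc k ] = lem _ _
  where
  lem : ∀ a b → a ≡ a - b + b
  lem = solve-∀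

-- Crossing numbers

crossing-horizontal : ∀ c x x′ y → crossing c (x , y) (x′ , y) ≡ 0ℤ
crossing-horizontal (a , b) x x′ y with a <? x | y ≟ b | y ≟ b + 1ℤ
... | no _  | _        | _        = refl
... | yes _ | no _     | no _     = refl
... | yes _ | no _     | yes _    = refl
... | yes _ | yes _    | no _     = refl
... | yes _ | yes refl | yes y≡b+1 = contradiction y≡b+1 (≢+1 y)

crossing-antisym : ∀ c x y y′ → crossing c (x , y) (x , y′) ≡ - crossing c (x , y′) (x , y)
crossing-antisym (a , b) x y y′ with a <? x | y ≟ b | y ≟ b + 1ℤ | y′ ≟ b | y′ ≟ b + 1ℤ
... | no _  | _        | _     | _        | _     = refl
... | yes _ | yes refl | yes e | _        | _     = contradiction e (≢+1 y)
... | yes _ | _        | _     | yes refl | yes e = contradiction e (≢+1 y′)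
... | yes _ | yes _    | no _  | yes _    | no _  = refl
... | yes _ | yes _    | no _  | no _     | yes _ = refl
... | yes _ | yes _    | no _  | no _     | no _  = refl
... | yes _ | no _     | yes _ | yes _    | no _  = refl
... | yes _ | no _     | yes _ | no _     | yes _ = refl
... | yes _ | no _     | yes _ | no _     | no _  = refl
... | yes _ | no _     | no _  | yes _    | no _  = refl
... | yes _ | no _     | no _  | no _     | yes _ = refl
... | yes _ | no _     | no _  | no _     | no _  = refl

crossing-north : ∀ a b x y → a < x → y ≡ b → crossing (a , b) (x , y) (x , y + 1ℤ) ≡ 1ℤ
crossing-north a b x .b a<x refl with a <? x | b ≟ b | b + 1ℤ ≟ b + 1ℤ
... | yes _   | yes _  | yes _  = refl
... | no a≮x  | _      | _      = contradiction a<x a≮x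
... | yes _   | no b≢b | _      = contradiction refl b≢b
... | yes _   | yes _  | no b≢b = contradiction refl b≢b

crossing-north-column : ∀ a b x y → ¬ a < x → crossing (a , b) (x , y) (x , y + 1ℤ) ≡ 0ℤ
crossing-north-column a b x y a≮x with a <? x
... | yes a<x = contradiction a<x a≮x
... | no _    = refl

crossing-north-row : ∀ a b x y → y ≢ b → crossing (a , b) (x , y) (x , y + 1ℤ) ≡ 0ℤ
crossing-north-row a b x y y≢b with a <? x | y ≟ b | y ≟ b + 1ℤ | y + 1ℤ ≟ b
... | no _  | _       | _        | _     = refl
... | yes _ | yes y≡b | _        | _     = contradiction y≡b y≢b
... | yes _ | no _    | no _     | _     = refl
... | yes _ | no _    | yes _    | no _  = refl
... | yes _ | no _    | yes refl | yes e = contradiction (sym e) (≢+2 b)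

-- Discrete 1-forms on the edges of the grid

module Form (hor ver : ℤ → ℤ → ℤ) where

  form : OrientedEdge → ℤ
  form ((x , y) , east)  = hor x y
  form ((x , y) , north) = ver x y
  form ((x , y) , west)  = - hor (x - 1ℤ) y
  form ((x , y) , south) = - ver x (y - 1ℤ)

  -- The counterclockwise circulation around the cell: bottom, right side, then top and left side
  -- backwards.
  curl : Square → ℤ
  curl (x , y) = hor x y + ver (x + 1ℤ) y - hor x (y + 1ℤ) - ver x y

  -- A walk of squares is followed along the path of their south-west corners; winding c is
  -- then the winding number of that path around the cell [a , a + 1] × [b , b + 1], where c = (a , b).
  heading : ∀ {s t} → Adjacent s t → ∃[ d ] head (s , d) ≡ t
  heading ((_       , east)  , inj₁ (refl , refl)) = south , refl
  heading (((x , y) , north) , inj₁ (refl , refl)) = east  , cong (_, y) (-1+1 x)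
  heading (((x , y) , west)  , inj₁ (refl , refl)) = north , cong (x - 1ℤ ,_) (-1+1 y)
  heading ((_       , south) , inj₁ (refl , refl)) = west  , refl
  heading (((x , y) , east)  , inj₂ (refl , refl)) = north , cong (x ,_) (-1+1 y)
  heading ((_       , north) , inj₂ (refl , refl)) = west  , refl
  heading ((_       , west)  , inj₂ (refl , refl)) = south , refl
  heading (((x , y) , south) , inj₂ (refl , refl)) = east  , cong (_, y - 1ℤ) (-1+1 x)

  ∫ : ∀ {P s t} → Walk P s t → ℤ
  ∫ ε                              = 0ℤ
  ∫ (_◅_ {i = s} (_ , _ , adj) γ) = form (s , proj₁ (heading adj)) + ∫ γ

  -- `A y x` integrates the form along the horizontal line at height `y`, from abscissa 0 to `x`.
  A : ℤ → ℤ → ℤ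
  A y = antidifference (λ x → hor x y)

  A-+1 : ∀ y x → A y (x + 1ℤ) ≡ A y x + hor x y
  A-+1 y = antidifference-+1 (λ x → hor x y)

  module Box (x₀ y₀ : ℤ) (M : ℕ) where

    InBox : Square → Set
    InBox (x , y) = (∃[ i ] i ℕ.< M × x ≡ x₀ + + i) × (∃[ j ] j ℕ.< M × y ≡ y₀ + + j)

    cell : ℕ → ℕ → Square
    cell i j = x₀ + + i , y₀ + + j

    flux : (Square → ℤ) → ℤ
    flux w = ∑ M λ j → ∑ M λ i → w (cell i j) * curl (cell i j)

    flux-cong : ∀ {v w} → (∀ c → v c ≡ w c) → flux v ≡ flux w
    flux-cong v≗w = ∑-cong M λ j → ∑-cong M λ i → cong (_* curl (cell i j)) (v≗w (cell i j))

    flux-+ : ∀ v w → flux (λ c → v c + w c) ≡ flux v + flux w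
    flux-+ v w = trans
      (∑-cong M λ j → trans (∑-cong M λ i → ℤ.*-distribʳ-+ (curl (cell i j)) (v (cell i j)) (w (cell i j))) (∑-+ M _ _))
      (∑-+ M _ _)

    flux-neg : ∀ v → flux (λ c → - v c) ≡ - flux v
    flux-neg v = trans
      (∑-cong M λ j → trans (∑-cong M λ i → sym (ℤ.neg-distribˡ-* (v (cell i j)) (curl (cell i j)))) (∑-neg M _))
      (∑-neg M _)

    flux-zero : ∀ {v} → (∀ c → v c * curl c ≡ 0ℤ) → flux v ≡ 0ℤ
    flux-zero vc≗0 = ∑-zero M λ _ → ∑-zero M λ _ → vc≗0 _

    -- Up to a constant, the integral along the line of abscissa `x₀` to height `y`, then along the
    -- row to `x`. On horizontal steps its difference is the form itself; on a vertical step the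
    -- error is the curl between the line and the edge.
    Φ : Point → ℤ
    Φ (x , y) = antidifference (ver x₀) y + (A y x - A y x₀)

    -- A primitive of the curl along row `y`, as `C-+1` shows; it turns the flux through a row into
    -- a telescoping sum.
    C : ℤ → ℤ → ℤ
    C y x = ver x y - A (y + 1ℤ) x + A y x

    C-+1 : ∀ y x → C y (x + 1ℤ) - C y x ≡ curl (x , y)
    C-+1 y x rewrite A-+1 y x | A-+1 (y + 1ℤ) x =
      lem (ver x y) (hor x y) (ver (x + 1ℤ) y) (hor x (y + 1ℤ)) (A y x) (A (y + 1ℤ) x)
      where
      lem : ∀ v h v′ h′ a a′ → v′ - (a′ + h′) + (a + h) - (v - a′ + a) ≡ h + v′ - h′ - v
      lem = solve-∀

    -- The ray from a cell meets this vertical step only if the cell lies in the same row and west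
    -- of it. The curls of these cells, from column `x₀` on, telescope through `C`.
    flux-north : ∀ {i j} → i ℕ.≤ M → j ℕ.< M → ∀ {x y} → x ≡ x₀ + + i → y ≡ y₀ + + j →
                 flux (λ c → crossing c (x , y) (x , y + 1ℤ)) ≡ C y x - C y x₀
    flux-north {i₀} {j₀} i₀≤M j₀<M {x} {y} refl refl = trans
      (∑-single j₀<M λ {j} j≢j₀ → ∑-zero M λ {i} _ → cong (_* curl (cell i j))
        (crossing-north-row (x₀ + + i) (y₀ + + j) x y
          λ eq → j≢j₀ (sym (ℤ.+-injective (+-cancelˡ y₀ _ _ eq)))))
      (trans
        (∑-telescope (λ i → C y (x₀ + + i)) i₀≤M
          (λ {i} i<i₀ → trans
            (cong (_* curl (x₀ + + i , y))
              (crossing-north (x₀ + + i) y x y (ℤ.+-monoʳ-< x₀ (+<+ i<i₀)) refl))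
            (trans (ℤ.*-identityˡ _)
              (trans (sym (C-+1 y (x₀ + + i)))
                (cong (λ z → C y z - C y (x₀ + + i))
                  (trans (ℤ.+-assoc x₀ (+ i) 1ℤ) (cong (λ k → x₀ + + k) (ℕ.+-comm i 1)))))))
          (λ {i} i₀≤i → cong (_* curl (x₀ + + i , y))
            (crossing-north-column (x₀ + + i) y x y
              (ℤ.≤⇒≯ (ℤ.+-monoʳ-≤ x₀ (+≤+ i₀≤i))))))
        (cong (λ z → C y x - C y z) (ℤ.+-identityʳ x₀)))

    form-north : ∀ {x y} → InBox (x , y) →
      ver x y ≡ Φ (x , y + 1ℤ) - Φ (x , y) + flux (λ c → crossing c (x , y) (x , y + 1ℤ))
    form-north {x} {y} ((i , i<M , x≡) , (j , j<M , y≡))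
      rewrite flux-north (ℕ.<⇒≤ i<M) j<M x≡ y≡ | antidifference-+1 (ver x₀) y =
      lem (ver x y) (ver x₀ y) (antidifference (ver x₀) y) (A y x) (A (y + 1ℤ) x) (A y x₀) (A (y + 1ℤ) x₀)
      where
      lem : ∀ v v₀ p a a⁺ a₀ a₀⁺ →
            v ≡ p + v₀ + (a⁺ - a₀⁺) - (p + (a - a₀)) + (v - a⁺ + a - (v₀ - a₀⁺ + a₀))
      lem = solve-∀

    form-step : ∀ {p} d → InBox p → InBox (head (p , d)) →
      form (p , d) ≡ Φ (head (p , d)) - Φ p + flux (λ c → crossing c p (head (p , d)))
    form-step {x , y} east _ _
      rewrite flux-cong {w = λ _ → 0ℤ} (λ c → crossing-horizontal c x (x + 1ℤ) y)
            | flux-zero {λ _ → 0ℤ} (λ _ → refl) | A-+1 y x =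
      lem (hor x y) (antidifference (ver x₀) y) (A y x) (A y x₀)
      where
      lem : ∀ h p a b → h ≡ p + (a + h - b) - (p + (a - b)) + 0ℤ
      lem = solve-∀
    form-step {x , y} west _ _
      rewrite flux-cong {w = λ _ → 0ℤ} (λ c → crossing-horizontal c x (x - 1ℤ) y)
            | flux-zero {λ _ → 0ℤ} (λ _ → refl) =
      trans (lem (hor (x - 1ℤ) y) (antidifference (ver x₀) y) (A y (x - 1ℤ)) (A y x₀))
        (cong (λ a → antidifference (ver x₀) y + (A y (x - 1ℤ) - A y x₀) - (antidifference (ver x₀) y + (a - A y x₀)) + 0ℤ)
          (trans (sym (A-+1 y (x - 1ℤ))) (cong (A y) (-1+1 x))))
      where
      lem : ∀ h p a b → - h ≡ p + (a - b) - (p + (a + h - b)) + 0ℤ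
      lem = solve-∀
    form-step {x , y} north box _ = form-north box
    form-step {x , y} south _ box =
      trans (cong -_ (form-north box))
      (trans (cong (λ z → - (Φ (x , z) - Φ (x , y - 1ℤ) + flux (λ c → crossing c (x , y - 1ℤ) (x , z)))) (-1+1 y))
      (trans (lem (Φ (x , y)) (Φ (x , y - 1ℤ)) _)
             (cong (_+_ (Φ (x , y - 1ℤ) - Φ (x , y)))
               (trans (sym (flux-neg (λ c → crossing c (x , y - 1ℤ) (x , y))))
                 (flux-cong λ c → sym (crossing-antisym c x y (y - 1ℤ)))))))
      where
      lem : ∀ a b f → - (a - b + f) ≡ b - a + - f
      lem = solve-∀

    -- Open walks are allowed, at the price of a boundary term in `Φ`, so that induction on the walk
    -- applies. For a closed walk that term cancels.
    stokes : ∀ {P s t} → (∀ {u} → P u → InBox u) → (γ : Walk P s t) →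
             ∫ γ ≡ Φ t - Φ s + flux (λ c → winding c γ)
    stokes {s = s} box ε rewrite flux-zero {λ _ → 0ℤ} (λ _ → refl) = lem (Φ s)
      where
      lem : ∀ a → 0ℤ ≡ a - a + 0ℤ
      lem = solve-∀
    stokes {s = s} {t} box (_◅_ {j = u} (Ps , Pu , adj) γ) with heading adj
    ... | d , refl =
      trans (cong₂ _+_ (form-step d (box Ps) (box Pu)) (stokes box γ))
      (trans (lem (Φ s) (Φ u) (Φ t) _ _)
             (cong (_+_ (Φ t - Φ s)) (sym (flux-+ (λ c → crossing c s u) (λ c → winding c γ)))))
      where
      lem : ∀ a b c f g → b - a + f + (c - b + g) ≡ c - a + (f + g)
      lem = solve-∀

bounded : ∀ (R : List Square) → ∃[ K ] (∀ {x y} → (x , y) ∈ R → ∣ x ∣ ℕ.< K × ∣ y ∣ ℕ.< K)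
bounded [] = 0 , λ ()
bounded ((a , b) ∷ R) with bounded R
... | K , ih = suc (∣ a ∣ ℕ.+ ∣ b ∣) ℕ.+ K , λ
  { (here refl) → ℕ.m≤n⇒m≤n+o K (ℕ.s≤s (ℕ.m≤m+n _ _)) , ℕ.m≤n⇒m≤n+o K (ℕ.s≤s (ℕ.m≤n+m _ _))
  ; (there u∈R) → ℕ.m≤n⇒m≤o+n _ (proj₁ (ih u∈R)) , ℕ.m≤n⇒m≤o+n _ (proj₂ (ih u∈R)) }

shifted : ∀ {K} z → ∣ z ∣ ℕ.< K → ∃[ i ] i ℕ.< K ℕ.+ K × z ≡ - + K + + i
shifted {K} z ∣z∣<K = ∣ z + + K ∣ , ℕ.≤-<-trans (ℤ.∣i+j∣≤∣i∣+∣j∣ z (+ K)) (ℕ.+-monoˡ-< K ∣z∣<K) ,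
  trans (lem z (+ K)) (cong (_+_ (- + K)) (sym (nonneg z ∣z∣<K)))
  where
  lem : ∀ z k → z ≡ - k + (z + k)
  lem = solve-∀
  nonneg : ∀ z → ∣ z ∣ ℕ.< K → + ∣ z + + K ∣ ≡ z + + K
  nonneg (+ _)    _   = refl
  nonneg -[1+ k ] k<K rewrite ℤ.⊖-≥ (ℕ.<⇒≤ k<K) = refl

-- Path integrals and potentials on a simply connected region

module Potential (hor ver : ℤ → ℤ → ℤ) (R : List Square)
  (conn : Connected R) (sconn : SimplyConnected R)
  (closed : ∀ {s} → s ∈ R → Form.curl hor ver s ≡ 0ℤ) where

  open Form hor ver

  ∫-◅◅ : ∀ {P s t u} (γ : Walk P s t) (δ : Walk P t u) → ∫ (γ ◅◅ δ) ≡ ∫ γ + ∫ δ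
  ∫-◅◅ ε δ = sym (ℤ.+-identityˡ _)
  ∫-◅◅ ((_ , _ , adj) ◅ γ) δ = trans (cong (_+_ (form (_ , proj₁ (heading adj)))) (∫-◅◅ γ δ))
    (sym (ℤ.+-assoc (form (_ , proj₁ (heading adj))) (∫ γ) (∫ δ)))

  -- Each cell contributes zero for one of two reasons: on `R` the curl vanishes, elsewhere the
  -- winding number does, whatever the curl is there.
  ∫-loop : ∀ {s} (γ : Walk (_∈ R) s s) → ∫ γ ≡ 0ℤ
  ∫-loop {s} γ with bounded R
  ... | K , bound = trans (stokes (λ u∈R → shifted _ (proj₁ (bound u∈R)) , shifted _ (proj₂ (bound u∈R))) γ)
    (cong₂ _+_ (ℤ.+-inverseʳ (Φ s)) (flux-zero {λ c → winding c γ} vanishing))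
    where
    -- All coordinates are below `K` in absolute value, so the box starts at `- K` and has side
    -- `2K`.
    open Box (- + K) (- + K) (K ℕ.+ K)
    vanishing : ∀ c → winding c γ * curl c ≡ 0ℤ
    vanishing c with c ∈? R
    ... | yes c∈R = trans (cong (winding c γ *_) (closed c∈R)) (ℤ.*-zeroʳ (winding c γ))
    ... | no  c∉R = cong (_* curl c)
      (decidable-stable (winding c γ ≟ 0ℤ) λ w≢0 → sconn c∉R (s , γ , w≢0))

  ∫-unique : ∀ {s t} (γ δ : Walk (_∈ R) s t) → ∫ γ ≡ ∫ δ
  ∫-unique γ δ = +-cancelʳ (∫ κ) (∫ γ) (∫ δ) (trans (loop γ) (sym (loop δ)))
    where
    κ = Walk-sym γ
    loop : ∀ γ → ∫ γ + ∫ κ ≡ 0ℤ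
    loop γ = trans (sym (∫-◅◅ γ κ)) (∫-loop (γ ◅◅ κ))

  B : ℤ → ℤ → ℤ
  B x = antidifference (λ y → ver x y)

  -- The integral from the south-west corner of a square to a point, first horizontally, then vertically.
  Ψ : Square → Point → ℤ
  Ψ (x , y) (p , q) = A y p - A y x + (B p q - B p y)

  -- Raising the starting corner moves the horizontal leg up by one row. This leg is empty if `p` is
  -- `x`; if `p` is `x + 1`, the two routes enclose just the square `(x , y)`, whose curl is zero.
  Ψ-north : ∀ {x y} p q → (x , y) ∈ R → p ≡ x ⊎ p ≡ x + 1ℤ →
            ver x y + Ψ (x , y + 1ℤ) (p , q) ≡ Ψ (x , y) (p , q)
  Ψ-north {x} {y} .x q _ (inj₁ refl) rewrite antidifference-+1 (λ y → ver x y) y =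
    lem (ver x y) (A y x) (A (y + 1ℤ) x) (B x y) (B x q)
    where
    lem : ∀ v a a⁺ b c → v + (a⁺ - a⁺ + (c - (b + v))) ≡ a - a + (c - b)
    lem = solve-∀
  Ψ-north {x} {y} .(x + 1ℤ) q s∈R (inj₂ refl)
    rewrite antidifference-+1 (λ y → ver (x + 1ℤ) y) y | A-+1 y x | A-+1 (y + 1ℤ) x =
    trans (lem (ver x y) (ver (x + 1ℤ) y) (hor x y) (hor x (y + 1ℤ)) (A y x) (A (y + 1ℤ) x) (B (x + 1ℤ) y) (B (x + 1ℤ) q))
      (trans (cong (λ c → A y x + hor x y - A y x + (B (x + 1ℤ) q - B (x + 1ℤ) y) - c) (closed s∈R)) (ℤ.+-identityʳ _))
    where
    lem : ∀ v v′ h h′ a a⁺ b c → v + (a⁺ + h′ - a⁺ + (c - (b + v′))) ≡ a + h - a + (c - b) - (h + v′ - h′ - v)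
    lem = solve-∀

  Ψ-step : ∀ {x y p q} d → (x , y) ∈ R → head ((x , y) , d) ∈ R →
           p ≡ x ⊎ p ≡ x + 1ℤ → form ((x , y) , d) + Ψ (head ((x , y) , d)) (p , q) ≡ Ψ (x , y) (p , q)
  Ψ-step {x} {y} {p} {q} east _ _ _ rewrite A-+1 y x = lem (hor x y) (A y x) (A y p) (B p q) (B p y)
    where
    lem : ∀ h a b c d → h + (b - (a + h) + (c - d)) ≡ b - a + (c - d)
    lem = solve-∀
  Ψ-step {x} {y} {p} {q} west _ _ _ =
    trans (lem (hor (x - 1ℤ) y) (A y (x - 1ℤ)) (A y p) (B p q) (B p y))
      (cong (λ a → A y p - a + (B p q - B p y)) (trans (sym (A-+1 y (x - 1ℤ))) (cong (A y) (-1+1 x))))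
    where
    lem : ∀ h a b c d → - h + (b - a + (c - d)) ≡ b - (a + h) + (c - d)
    lem = solve-∀
  Ψ-step {p = p} {q} north s∈R _ corner = Ψ-north p q s∈R corner
  Ψ-step {x} {y} {p} {q} south _ t∈R corner =
    trans (cong (_+_ (- ver x (y - 1ℤ))) (sym (Ψ-north p q t∈R corner)))
      (trans (lem (ver x (y - 1ℤ)) _) (cong (λ z → Ψ (x , z) (p , q)) (-1+1 y)))
    where
    lem : ∀ v a → - v + (v + a) ≡ a
    lem = solve-∀

  -- This makes the potential respect `SameVertex`. The walk stays among squares around `p`, so the
  -- two vertices at a pinch point are never compared.
  around : ∀ {p s t} → Walk (λ s → s ∈ R × IsCorner p s) s t → Σ[ γ ∈ Walk (_∈ R) s t ] ∫ γ + Ψ t p ≡ Ψ s p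
  around ε = ε , ℤ.+-identityˡ _
  around {p} {s} {t} (_◅_ {j = u} ((s∈R , s∋p) , (u∈R , u∋p) , adj) γ) with around γ
  ... | δ , ih = (s∈R , u∈R , adj) ◅ δ ,
    trans (ℤ.+-assoc (form (s , proj₁ (heading adj))) (∫ δ) (Ψ t p))
      (trans (cong (_+_ (form (s , proj₁ (heading adj)))) ih) (step (heading adj)))
    where
    step : ((d , _) : ∃[ d ] head (s , d) ≡ u) → form (s , d) + Ψ u p ≡ Ψ s p
    step (d , refl) = Ψ-step {q = proj₂ p} d s∈R u∈R (proj₁ s∋p)

  Ψ-vertical : ∀ x′ x y → Ψ (x′ , y) (x , y + 1ℤ) - Ψ (x′ , y) (x , y) ≡ ver x y
  Ψ-vertical x′ x y rewrite antidifference-+1 (λ y → ver x y) y = lem (ver x y) (A y x) (A y x′) (B x y)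
    where
    lem : ∀ v a b c → a - b + (c + v - c) - (a - b + (c - c)) ≡ v
    lem = solve-∀

  Ψ-bottom : ∀ x y → Ψ (x , y) (x + 1ℤ , y) - Ψ (x , y) (x , y) ≡ hor x y
  Ψ-bottom x y rewrite A-+1 y x = lem (hor x y) (A y x) (B (x + 1ℤ) y) (B x y)
    where
    lem : ∀ h a b c → a + h - a + (b - b) - (a - a + (c - c)) ≡ h
    lem = solve-∀

  -- `Ψ` reaches the north-east corner by the bottom and the right side, the north-west corner by
  -- the left side. Trading these for the top side costs the curl, which is zero on `R`.
  Ψ-top : ∀ x y → (x , y) ∈ R → Ψ (x , y) (x + 1ℤ , y + 1ℤ) - Ψ (x , y) (x , y + 1ℤ) ≡ hor x (y + 1ℤ)
  Ψ-top x y s∈R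
    rewrite A-+1 y x | antidifference-+1 (λ y → ver x y) y | antidifference-+1 (λ y → ver (x + 1ℤ) y) y =
    trans (lem (ver x y) (ver (x + 1ℤ) y) (hor x y) (hor x (y + 1ℤ)) (A y x) (B (x + 1ℤ) y) (B x y))
      (trans (cong (_+_ (hor x (y + 1ℤ))) (closed s∈R)) (ℤ.+-identityʳ _))
    where
    lem : ∀ v v′ h h′ a b c →
          a + h - a + (b + v′ - b) - (a - a + (c + v - c)) ≡ h′ + (h + v′ - h′ - v)
    lem = solve-∀

  Ψ-horizontal : ∀ x y {s} → s ∈ R → s ≡ (x , y) ⊎ s ≡ (x , y - 1ℤ) →
                 Ψ s (x + 1ℤ , y) - Ψ s (x , y) ≡ hor x y
  Ψ-horizontal x y _   (inj₁ refl) = Ψ-bottom x y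
  Ψ-horizontal x y s∈R (inj₂ refl) =
    subst (λ z → Ψ (x , y - 1ℤ) (x + 1ℤ , z) - Ψ (x , y - 1ℤ) (x , z) ≡ hor x z) (-1+1 y) (Ψ-top x (y - 1ℤ) s∈R)

  Ψ-edge : ∀ e {s} → s ∈ R → s ≡ left e ⊎ s ≡ right e → Ψ s (head e) - Ψ s (tail e) ≡ form e
  Ψ-edge ((x , y) , east)  s∈R incident = Ψ-horizontal x y s∈R incident
  Ψ-edge ((x , y) , north) _ (inj₁ refl) = Ψ-vertical (x - 1ℤ) x y
  Ψ-edge ((x , y) , north) _ (inj₂ refl) = Ψ-vertical x x y
  Ψ-edge ((x , y) , west) {s} s∈R incident = trans (flip (Ψ s (x - 1ℤ , y)) (Ψ s (x , y)))
    (cong -_ (trans (cong (λ z → Ψ s (z , y) - Ψ s (x - 1ℤ , y)) (sym (-1+1 x)))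
                    (Ψ-horizontal (x - 1ℤ) y s∈R (Sum.swap incident))))
    where
    flip : ∀ a b → a - b ≡ - (b - a)
    flip = solve-∀
  Ψ-edge ((x , y) , south) {s} _ incident = trans (flip (Ψ s (x , y - 1ℤ)) (Ψ s (x , y)))
    (cong -_ (trans (cong (λ z → Ψ s (x , z) - Ψ s (x , y - 1ℤ)) (sym (-1+1 y))) (vertical incident)))
    where
    flip : ∀ a b → a - b ≡ - (b - a)
    flip = solve-∀
    vertical : s ≡ (x , y - 1ℤ) ⊎ s ≡ (x - 1ℤ , y - 1ℤ) →
               Ψ s (x , y - 1ℤ + 1ℤ) - Ψ s (x , y - 1ℤ) ≡ ver x (y - 1ℤ)
    vertical (inj₁ refl) = Ψ-vertical x x (y - 1ℤ)
    vertical (inj₂ refl) = Ψ-vertical (x - 1ℤ) x (y - 1ℤ)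

  module _ (v₀ : Vertex R) where

    -- The integral runs between the south-west corners of the two squares; the `Ψ` terms correct
    -- for the legs from these corners to `v` and to `v₀`.
    potential : Vertex R → ℤ
    potential v = ∫ (conn (square∈R v₀) (square∈R v)) + Ψ (square v) (point v) - Ψ (square v₀) (point v₀)

    potential-base : potential v₀ ≡ 0ℤ
    potential-base rewrite ∫-loop (conn (square∈R v₀) (square∈R v₀)) = lem (Ψ (square v₀) (point v₀))
      where
      lem : ∀ a → 0ℤ + a - a ≡ 0ℤ
      lem = solve-∀

    potential-cong : ∀ {v w} → SameVertex R v w → potential v ≡ potential w
    potential-cong {v} {w} (refl , γ) with around γ
    ... | δ , eq = cong (_- Ψ (square v₀) (point v₀)) (begin
      ∫ to-v + Ψ (square v) p               ≡⟨ cong (_+_ (∫ to-v)) eq ⟨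
      ∫ to-v + (∫ δ + Ψ (square w) p)       ≡⟨ ℤ.+-assoc (∫ to-v) (∫ δ) _ ⟨
      ∫ to-v + ∫ δ + Ψ (square w) p         ≡⟨ cong (_+ Ψ (square w) p) (∫-◅◅ to-v δ) ⟨
      ∫ (to-v ◅◅ δ) + Ψ (square w) p        ≡⟨ cong (_+ Ψ (square w) p) (∫-unique (to-v ◅◅ δ) to-w) ⟩
      ∫ to-w + Ψ (square w) p               ∎)
      where
      open ≡-Reasoning
      p = point v
      to-v = conn (square∈R v₀) (square∈R v)
      to-w = conn (square∈R v₀) (square∈R w)

    potential-edge : ∀ {e v w} → EdgeFromTo R e v w → potential w - potential v ≡ form e
    potential-edge {e} {record { square = s ; square∈R = s∈R }} {record { square∈R = s∈R′ }}
      record { sameSquare = refl ; incident = incident ; from = refl ; to = refl } =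
      -- The two vertices share a square but may carry different membership proofs, for which `conn`
      -- may return different walks.
      trans (cong (λ i → i + Ψ s (head e) - c - (∫ γ + Ψ s (tail e) - c)) (∫-unique (conn (square∈R v₀) s∈R′) γ))
        (trans (lem (∫ γ) (Ψ s (head e)) (Ψ s (tail e)) c) (Ψ-edge e s∈R incident))
      where
      γ = conn (square∈R v₀) s∈R
      c = Ψ (square v₀) (point v₀)
      lem : ∀ i a b c → i + a - c - (i + b - c) ≡ a - b
      lem = solve-∀

-- Edges with the higher-level square on their left

data Ascending : OrientedEdge → Set where
  east  : ∀ {p} → Ascending (p , east)
  south : ∀ {p} → Ascending (p , south)

southEdge northEdge westEdge eastEdge : Square → OrientedEdge
southEdge s       = s , east
northEdge (x , y) = (x , y + 1ℤ) , east
westEdge  (x , y) = (x , y + 1ℤ) , south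
eastEdge  (x , y) = (x + 1ℤ , y + 1ℤ) , south

right-northEdge : ∀ s → right (northEdge s) ≡ s
right-northEdge (x , y) = cong (x ,_) (+1-1 y)

left-westEdge : ∀ s → left (westEdge s) ≡ s
left-westEdge (x , y) = cong (x ,_) (+1-1 y)

right-eastEdge : ∀ s → right (eastEdge s) ≡ s
right-eastEdge (x , y) = cong₂ _,_ (+1-1 x) (+1-1 y)

level-ascending : ∀ {e} → Ascending e → level (left e) ≡ level (right e) + 1ℤ
level-ascending {(x , y) , _} east = lem x y
  where
  lem : ∀ x y → x + y ≡ x + (y - 1ℤ) + 1ℤ
  lem = solve-∀
level-ascending {(x , y) , _} south = lem x y
  where
  lem : ∀ x y → x + (y - 1ℤ) ≡ x - 1ℤ + (y - 1ℤ) + 1ℤ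
  lem = solve-∀

ascending : ∀ e → level (left e) ≡ level (right e) + 1ℤ → Ascending e
ascending (_ , east)  _ = east
ascending (_ , south) _ = south
ascending ((x , y) , north) higher = ⊥-elim (≢+2 (x - 1ℤ + y) (trans higher (lem x y)))
  where
  lem : ∀ x y → x + y + 1ℤ ≡ x - 1ℤ + y + 1ℤ + 1ℤ
  lem = solve-∀
ascending ((x , y) , west) higher = ⊥-elim (≢+2 (x - 1ℤ + (y - 1ℤ)) (trans higher (lem x y)))
  where
  lem : ∀ x y → x - 1ℤ + y + 1ℤ ≡ x - 1ℤ + (y - 1ℤ) + 1ℤ + 1ℤ
  lem = solve-∀

ascending-left : ∀ {e} → Ascending e → e ≡ southEdge (left e) ⊎ e ≡ westEdge (left e)
ascending-left east = inj₁ refl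
ascending-left {(x , y) , _} south = inj₂ (cong (λ z → (x , z) , south) (sym (-1+1 y)))

ascending-right : ∀ {e} → Ascending e → e ≡ northEdge (right e) ⊎ e ≡ eastEdge (right e)
ascending-right {(x , y) , _} east  = inj₁ (cong (λ z → (x , z) , east) (sym (-1+1 y)))
ascending-right {(x , y) , _} south = inj₂ (cong₂ (λ w z → (w , z) , south) (sym (-1+1 x)) (sym (-1+1 y)))

Separates : OrientedEdge → Square → Square → Set
Separates e s t = left e ≡ s × right e ≡ t ⊎ left e ≡ t × right e ≡ s

adjacent-ascending : ∀ {s t} → Adjacent s t → ∃[ e ] Ascending e × Separates e s t
adjacent-ascending ((p , east)  , sides) = (p , east) , east  , sides
adjacent-ascending ((p , south) , sides) = (p , south) , south , sides
adjacent-ascending (((x , y) , west) , sides) = ((x - 1ℤ , y) , east) , east ,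
  Sum.map (λ (l , r) → r , l) (λ (l , r) → r , l) (Sum.swap sides)
adjacent-ascending {s} {t} (((x , y) , north) , sides) = ((x , y + 1ℤ) , south) , south ,
  subst (λ z → (x , z) ≡ s × (x - 1ℤ , z) ≡ t ⊎ (x , z) ≡ t × (x - 1ℤ , z) ≡ s) (sym (+1-1 y))
    (Sum.map (λ (l , r) → r , l) (λ (l , r) → r , l) (Sum.swap sides))

-- Levels along walks

<⇒+1≤ : ∀ {i j} → i < j → i + 1ℤ ≤ j
<⇒+1≤ {i} {j} i<j = subst (_≤ j) (ℤ.+-comm 1ℤ i) (ℤ.i<j⇒suc[i]≤j i<j)

<+1⇒≤ : ∀ {i j} → i < j + 1ℤ → i ≤ j
<+1⇒≤ {i} {j} i<j+1 = ℤ.≮⇒≥ λ j<i → ℤ.<-irrefl refl (ℤ.<-≤-trans i<j+1 (<⇒+1≤ j<i))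

i<i+1 : ∀ i → i < i + 1ℤ
i<i+1 i = subst (_< i + 1ℤ) (ℤ.+-identityʳ i) (ℤ.+-monoʳ-< i (+<+ ℕ.≤-refl))

-- A discrete intermediate value argument: a step changes the level by exactly one, so the first
-- step that drops below `m` leaves a square of level `m`.
descent : ∀ {P s t} (γ : Walk P s t) m → level t < m → m ≤ level s →
  ∃[ e ] Ascending e × P (left e) × P (right e) × level (left e) ≡ m
descent ε m t<m m≤s = ⊥-elim (ℤ.<⇒≱ t<m m≤s)
descent (_◅_ {i = s} {j = u} (Ps , Pu , adj) γ) m t<m m≤s with m ≤? level u
... | yes m≤u = descent γ m t<m m≤u
... | no  m≰u with adjacent-ascending adj
...   | e , asc , inj₁ (refl , refl) = e , asc , Ps , Pu ,
  ℤ.≤-antisym (subst (_≤ m) (sym (level-ascending asc)) (<⇒+1≤ (ℤ.≰⇒> m≰u))) m≤s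
...   | e , asc , inj₂ (refl , refl) = ⊥-elim (m≰u (ℤ.≤-trans m≤s
  (subst (level s ≤_) (sym (level-ascending asc)) (ℤ.<⇒≤ (i<i+1 (level s))))))

module _ {A : Set} (f : A → ℤ) where

  open Extrema ℤ.≤-totalOrder

  ∃-argmin : ∀ {a} (xs : List A) → a ∈ xs → ∃[ b ] b ∈ xs × (∀ {c} → c ∈ xs → f b ≤ f c)
  ∃-argmin {a} xs a∈xs = argmin f a xs , member , λ c∈xs → All.lookup (f[argmin]≤f[xs] a xs) c∈xs
    where
    member : argmin f a xs ∈ xs
    member with argmin-sel f a xs
    ... | inj₁ eq = subst (_∈ xs) (sym eq) a∈xs
    ... | inj₂ ∈xs = ∈xs

  ∃-argmax : ∀ {a} (xs : List A) → a ∈ xs → ∃[ b ] b ∈ xs × (∀ {c} → c ∈ xs → f c ≤ f b)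
  ∃-argmax {a} xs a∈xs = argmax f a xs , member , λ c∈xs → All.lookup (f[xs]≤f[argmax] a xs) c∈xs
    where
    member : argmax f a xs ∈ xs
    member with argmax-sel f a xs
    ... | inj₁ eq = subst (_∈ xs) (sym eq) a∈xs
    ... | inj₂ ∈xs = ∈xs

-- Congruence modulo `n`, colours and levels

module Modulo (n : ℕ) .{{_ : NonZero n}} where

  infix 4 _∼_
  record _∼_ (a b : ℤ) : Set where
    constructor _,_
    field
      quotient : ℤ
      equation : a ≡ b + quotient * + n

  ∼-sym : ∀ {a b} → a ∼ b → b ∼ a
  ∼-sym {a} {b} (q , a≡) = - q , trans (lem b q (+ n)) (cong (_+ - q * + n) (sym a≡))
    where
    lem : ∀ b q n → b ≡ b + q * n + - q * n
    lem = solve-∀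

  ∼-trans : ∀ {a b c} → a ∼ b → b ∼ c → a ∼ c
  ∼-trans {c = c} (p , refl) (q , refl) = q + p , lem c p q (+ n)
    where
    lem : ∀ c p q n → c + q * n + p * n ≡ c + (q + p) * n
    lem = solve-∀

  ∼-+ : ∀ {a b} c → a ∼ b → a + c ∼ b + c
  ∼-+ {b = b} c (q , refl) = q , lem b c (q * + n)
    where
    lem : ∀ b c d → b + d + c ≡ b + c + d
    lem = solve-∀

  ≡⇒∼ : ∀ {a b} → a ≡ b → a ∼ b
  ≡⇒∼ {a} refl = 0ℤ , sym (ℤ.+-identityʳ a)

  remainder-unique : ∀ {r r′} → r ℕ.< n → r′ ℕ.< n → + r ∼ + r′ → r ≡ r′
  remainder-unique {r} {r′} r<n r′<n (q , eq) = go q eq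
    where
    large : ∀ {r r′ k} → r ℕ.< n → + r ≢ + r′ + + suc k * + n
    large {r} {r′} {k} r<n eq = ℕ.<⇒≱ r<n
      (subst (n ℕ.≤_) (sym (ℤ.+-injective (trans eq (cong (_+_ (+ r′)) (sym (ℤ.pos-* (suc k) n))))))
        (ℕ.≤-trans (ℕ.m≤m+n n (k ℕ.* n)) (ℕ.m≤n+m _ r′)))
    go : ∀ q → + r ≡ + r′ + q * + n → r ≡ r′
    go (+ zero)  eq = ℤ.+-injective (trans eq (ℤ.+-identityʳ _))
    go (+ suc k) eq = ⊥-elim (large {k = k} r<n eq)
    go -[1+ k ]  eq = ⊥-elim (large {k = k} r′<n (_∼_.equation (∼-sym (-[1+ k ] , eq))))

  %ℕ-∼ : ∀ z → z ∼ + (z %ℕ n)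
  %ℕ-∼ z = z /ℕ n , a≡a%ℕn+[a/ℕn]*n z n

  %ℕ-unique : ∀ {z r} → r ℕ.< n → z ∼ + r → z %ℕ n ≡ r
  %ℕ-unique {z} r<n z∼r = remainder-unique (n%ℕd<d z n) r<n (∼-trans (∼-sym (%ℕ-∼ z)) z∼r)

  colour-∼ : ∀ s → level s ∼ + toℕ (colour n s)
  colour-∼ s = ∼-trans (%ℕ-∼ (level s)) (≡⇒∼ (cong +_ (sym (Fin.toℕ-fromℕ< (n%ℕd<d (level s) n)))))

  toℕ-∼-injective : ∀ {i j : Fin n} → + toℕ i ∼ + toℕ j → i ≡ j
  toℕ-∼-injective {i} {j} i∼j = Fin.toℕ-injective (remainder-unique (Fin.toℕ<n i) (Fin.toℕ<n j) i∼j)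

  colour-≡ : ∀ s {i} → level s ∼ + toℕ i → colour n s ≡ i
  colour-≡ s s∼i = toℕ-∼-injective (∼-trans (∼-sym (colour-∼ s)) s∼i)

  ≡-colour : ∀ s {i} → colour n s ≡ i → level s ∼ + toℕ i
  ≡-colour s refl = colour-∼ s

  next-∼ : ∀ i → + toℕ (next n i) ∼ + toℕ i + 1ℤ
  next-∼ i = ∼-sym (∼-trans (≡⇒∼ (cong +_ (ℕ.+-comm (toℕ i) 1)))
    (∼-trans (%ℕ-∼ (+ suc (toℕ i))) (≡⇒∼ (cong +_ (sym (Fin.toℕ-fromℕ< (ℕ.m%n<n (suc (toℕ i)) n)))))))

  next-injective : ∀ {i j} → next n i ≡ next n j → i ≡ j
  next-injective {i} {j} eq = toℕ-∼-injective
    (∼-trans (≡⇒∼ (sym (+1-1 (+ toℕ i))))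
    (∼-trans (∼-+ (- 1ℤ) (∼-trans (∼-sym (next-∼ i)) (∼-trans (≡⇒∼ (cong (λ k → + toℕ k) eq)) (next-∼ j))))
    (≡⇒∼ (+1-1 (+ toℕ j)))))

  colour-ascending : ∀ {e} → Ascending e → colour n (left e) ≡ next n (colour n (right e))
  colour-ascending {e} asc = colour-≡ (left e) (∼-trans (≡⇒∼ (level-ascending asc))
    (∼-trans (∼-+ 1ℤ (colour-∼ (right e))) (∼-sym (next-∼ (colour n (right e))))))

  colour-level : ∀ s t → level s ≡ level t → colour n s ≡ colour n t
  colour-level _ _ = cong λ z → fromℕ< (n%ℕd<d z n)

  +n-∼ : ∀ a → a + + n ∼ a
  +n-∼ a = 1ℤ , cong (_+_ a) (sym (ℤ.*-identityˡ (+ n)))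

  -- Since `a < b + 1`, the quotient can be neither zero nor negative, so it contributes at least
  -- one full `n`.
  ∼-gap : ∀ {a b} → a ≤ b → b + 1ℤ ∼ a → a + + n ≤ b + 1ℤ
  ∼-gap {a} {b} a≤b (q , eq) = go q eq
    where
    a<b+1 = ℤ.≤-<-trans a≤b (i<i+1 b)
    go : ∀ q → b + 1ℤ ≡ a + q * + n → a + + n ≤ b + 1ℤ
    go (+ zero)  eq = ⊥-elim (ℤ.<-irrefl (sym (trans eq (ℤ.+-identityʳ a))) a<b+1)
    go (+ suc k) eq = subst (a + + n ≤_) (sym (trans eq (cong (_+_ a) (sym (ℤ.pos-* (suc k) n)))))
                        (ℤ.+-monoʳ-≤ a (+≤+ (ℕ.m≤m+n n (k ℕ.* n))))
    go -[1+ k ]  eq = ⊥-elim (ℤ.<⇒≱ a<b+1 (subst (_≤ a) (sym eq')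
                        (subst (a - + m ≤_) (ℤ.+-identityʳ a) (ℤ.+-monoʳ-≤ a (ℤ.neg-≤-pos {m} {0})))))
      where
      m = suc k ℕ.* n
      eq' : b + 1ℤ ≡ a - + m
      eq' = trans eq (cong (_+_ a) (trans (sym (ℤ.neg-distribˡ-* (+ suc k) (+ n))) (cong -_ (sym (ℤ.pos-* (suc k) n)))))

-- The shape of a ribbon tile

module TileShape (n : ℕ) .{{_ : NonZero n}} (t : Tile n) where

  open Modulo n
  open Tile t

  colour-injective : ∀ {s u} → s ∈ squares → u ∈ squares → colour n s ≡ colour n u → s ≡ u
  colour-injective {s} {u} s∈t u∈t eq with colours (colour n u)
  ... | _ , _ , unique = trans (sym (unique (s∈t , eq))) (unique (u∈t , refl))

  level-injective : ∀ {s u} → s ∈ squares → u ∈ squares → level s ≡ level u → s ≡ u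
  level-injective {s} {u} s∈t u∈t eq = colour-injective s∈t u∈t (colour-level s u eq)

  module _ {l h s} (l∈t : l ∈ squares) (l≤ : ∀ {u} → u ∈ squares → level l ≤ level u)
           (h∈t : h ∈ squares) (≤h : ∀ {u} → u ∈ squares → level u ≤ level h)
           (s∈t : s ∈ squares) (s-colour : colour n s ≡ next n (colour n h)) where

    h+1 : level h + 1ℤ ∼ level s
    h+1 = ∼-trans (∼-+ 1ℤ (colour-∼ h)) (∼-trans (∼-sym (next-∼ (colour n h))) (∼-sym (≡-colour s s-colour)))

    gap : level s + + n ≤ level h + 1ℤ
    gap = ∼-gap (≤h s∈t) h+1

    -- A lower square would force a second square of its colour, n levels above it.
    s≤l : level s ≤ level l
    s≤l = ℤ.≮⇒≥ λ l<s →
      let l+n≤h : level l + + n ≤ level h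
          l+n≤h = <+1⇒≤ (ℤ.<-≤-trans (ℤ.+-monoˡ-< (+ n) l<s) gap)
          l<l+n : level l < level l + + n
          l<l+n = subst (_< level l + + n) (ℤ.+-identityʳ (level l)) (ℤ.+-monoʳ-< (level l) (+<+ (ℕ.>-nonZero⁻¹ n)))
          e , _ , u∈t , _ , u≡ = descent (connected h∈t l∈t) (level l + + n) l<l+n l+n≤h
          u≡l = colour-injective u∈t l∈t (colour-≡ (left e) (∼-trans (≡⇒∼ u≡) (∼-trans (+n-∼ (level l)) (colour-∼ l))))
      in ℤ.<-irrefl (trans (sym (cong level u≡l)) u≡) l<l+n

    extremes : TileOfType n (colour n h) t
    extremes = record
      { lowest = l ; highest = h ; lowest∈t = l∈t ; highest∈t = h∈t
      ; isLowest = l≤ ; isHighest = ≤h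
      ; lowestColour = trans (colour-level l s (ℤ.≤-antisym (l≤ s∈t) s≤l)) s-colour
      ; highestColour = refl }

  -- The type is the colour of a highest square. By `s≤l` the square of the next colour is no higher
  -- than a lowest square, so the two have the same level and hence the same colour.
  tileType : ∃[ j ] TileOfType n j t
  -- The colour of level 0 is an arbitrary choice; it provides a first square for the search for
  -- extremes.
  tileType with colours (fromℕ< (n%ℕd<d 0ℤ n))
  ... | _ , (a∈t , _) , _ with ∃-argmin level squares a∈t | ∃-argmax level squares a∈t
  ...   | l , l∈t , l≤ | h , h∈t , ≤h with colours (next n (colour n h))
  ...     | s , (s∈t , s-colour) , _ = colour n h , extremes l∈t l≤ h∈t ≤h s∈t s-colour

  module _ {j} (type : TileOfType n j t) {s} (s∈t : s ∈ squares) where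

    open TileOfType type

    ≡-next⇒bottom : colour n s ≡ next n j → ∀ {e} → Ascending e → left e ≡ s → right e ∉ squares
    ≡-next⇒bottom eq {e} asc refl r∈t = ℤ.<⇒≱ (subst (level (right e) <_) (sym (level-ascending asc)) (i<i+1 _))
      (subst (_≤ level (right e)) (cong level (colour-injective lowest∈t s∈t (trans lowestColour (sym eq)))) (isLowest r∈t))

    ≡⇒top : colour n s ≡ j → ∀ {e} → Ascending e → right e ≡ s → left e ∉ squares
    ≡⇒top eq {e} asc refl l∈t = ℤ.<⇒≱ (subst (level (right e) <_) (sym (level-ascending asc)) (i<i+1 _))
      (subst (level (left e) ≤_) (cong level (colour-injective highest∈t s∈t (trans highestColour (sym eq)))) (isHighest l∈t))

    -- A walk inside the tile from `s` to its lowest square must leave level `level s` downwards,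
    -- and `s` is the only square of the tile at that level.
    below : colour n s ≡ next n j ⊎ (∃[ e ] Ascending e × left e ≡ s × right e ∈ squares)
    below with level lowest <? level s
    ... | no l≮s = inj₁ (trans (colour-level s lowest (ℤ.≤-antisym (ℤ.≮⇒≥ l≮s) (isLowest s∈t))) lowestColour)
    ... | yes l<s with descent (connected s∈t lowest∈t) (level s) l<s ℤ.≤-refl
    ...   | e , asc , l∈t , r∈t , eq = inj₂ (e , asc , level-injective l∈t s∈t eq , r∈t)

    above : colour n s ≡ j ⊎ (∃[ e ] Ascending e × right e ≡ s × left e ∈ squares)
    above with level s <? level highest
    ... | no s≮h = inj₁ (trans (colour-level s highest (ℤ.≤-antisym (isHighest s∈t) (ℤ.≮⇒≥ s≮h))) highestColour)
    ... | yes s<h with descent (connected highest∈t s∈t) (level s + 1ℤ) (i<i+1 (level s)) (<⇒+1≤ s<h)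
    ...   | e , asc , l∈t , r∈t , eq = inj₂ (e , asc ,
              level-injective r∈t s∈t (+1-injective (trans (sym (level-ascending asc)) eq)) , l∈t)

south≢west : ∀ s → right (southEdge s) ≢ right (westEdge s)
south≢west s eq = ≢+1 _ (trans (sym (cong proj₁ eq)) (sym (-1+1 (proj₁ s))))

north≢east : ∀ s → left (northEdge s) ≢ left (eastEdge s)
north≢east s eq = ≢+1 _ (cong proj₁ eq)

-- Corners and gradients

tail-left : ∀ e → IsCorner (tail e) (left e)
tail-left (_       , east)  = inj₁ refl , inj₁ refl
tail-left ((x , y) , north) = inj₂ (sym (-1+1 x)) , inj₁ refl
tail-left ((x , y) , west)  = inj₂ (sym (-1+1 x)) , inj₂ (sym (-1+1 y))
tail-left ((x , y) , south) = inj₁ refl , inj₂ (sym (-1+1 y))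

tail-right : ∀ e → IsCorner (tail e) (right e)
tail-right ((x , y) , east)  = inj₁ refl , inj₂ (sym (-1+1 y))
tail-right (_       , north) = inj₁ refl , inj₁ refl
tail-right ((x , y) , west)  = inj₂ (sym (-1+1 x)) , inj₁ refl
tail-right ((x , y) , south) = inj₂ (sym (-1+1 x)) , inj₂ (sym (-1+1 y))

head-left : ∀ e → IsCorner (head e) (left e)
head-left (_       , east)  = inj₂ refl , inj₁ refl
head-left ((x , y) , north) = inj₂ (sym (-1+1 x)) , inj₂ refl
head-left ((x , y) , west)  = inj₁ refl , inj₂ (sym (-1+1 y))
head-left (_       , south) = inj₁ refl , inj₁ refl

head-right : ∀ e → IsCorner (head e) (right e)
head-right ((x , y) , east)  = inj₂ refl , inj₂ (sym (-1+1 y))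
head-right (_       , north) = inj₁ refl , inj₂ refl
head-right (_       , west)  = inj₁ refl , inj₁ refl
head-right ((x , y) , south) = inj₂ (sym (-1+1 x)) , inj₁ refl

module _ {R : List Square} where

  corner : ∀ {s} → s ∈ R → ∀ p → IsCorner p s → Vertex R
  corner {s} s∈R p c = record { square = s ; square∈R = s∈R ; point = p ; isCorner = c }

  sameVertex : ∀ v w → square v ≡ square w → point v ≡ point w → SameVertex R v w
  sameVertex record {} record {} refl refl = refl , ε

  sameVertex-across : ∀ e {p} (l∈R : left e ∈ R) (r∈R : right e ∈ R) (l∋p : IsCorner p (left e)) (r∋p : IsCorner p (right e)) →
                      SameVertex R (corner l∈R p l∋p) (corner r∈R p r∋p)
  sameVertex-across e l∈R r∈R l∋p r∋p = refl , ((l∈R , l∋p) , (r∈R , r∋p) , e , inj₁ (refl , refl)) ◅ ε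

  module Corners {x y} (s∈R : (x , y) ∈ R) where

    sw se nw ne : Vertex R
    sw = corner s∈R (x , y) (inj₁ refl , inj₁ refl)
    se = corner s∈R (x + 1ℤ , y) (inj₂ refl , inj₁ refl)
    nw = corner s∈R (x , y + 1ℤ) (inj₁ refl , inj₂ refl)
    ne = corner s∈R (x + 1ℤ , y + 1ℤ) (inj₂ refl , inj₂ refl)

    edge-south : EdgeFromTo R (southEdge (x , y)) sw se
    edge-south = record { sameSquare = refl ; incident = inj₁ refl ; from = refl ; to = refl }

    edge-west : EdgeFromTo R (westEdge (x , y)) nw sw
    edge-west = record
      { sameSquare = refl ; incident = inj₁ (sym (left-westEdge (x , y))) ; from = refl ; to = cong (x ,_) (sym (+1-1 y)) }

    edge-north : EdgeFromTo R (northEdge (x , y)) nw ne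
    edge-north = record { sameSquare = refl ; incident = inj₂ (sym (right-northEdge (x , y))) ; from = refl ; to = refl }

    edge-east : EdgeFromTo R (eastEdge (x , y)) ne se
    edge-east = record
      { sameSquare = refl ; incident = inj₂ (sym (right-eastEdge (x , y))) ; from = refl ; to = cong (x + 1ℤ ,_) (sym (+1-1 y)) }

-- Existence and uniqueness of functions with given increments

module _ {n : ℕ} .{{_ : NonZero n}} {R : List Square} where

  Gradient : VertexFunction n R → (OrientedEdge → Vector ℤ n) → Set
  Gradient h g = ∀ {e v w} → Ascending e → EdgeFromTo R e v w → ∀ k → (h ⟨$⟩ w) k - (h ⟨$⟩ v) k ≡ g e k

  -- The two sums follow the two ways around the square from its north-west to its south-east
  -- corner: down and right, or right and down.
  Balanced : (OrientedEdge → Vector ℤ n) → Square → Set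
  Balanced g s = ∀ k → g (southEdge s) k + g (westEdge s) k ≡ g (northEdge s) k + g (eastEdge s) k

  module _ (conn : Connected R) (v₀ : Vertex R) where

    integrate : SimplyConnected R → ∀ g → (∀ {s} → s ∈ R → Balanced g s) →
      Σ[ h ∈ VertexFunction n R ] (∀ k → (h ⟨$⟩ v₀) k ≡ 0ℤ) × Gradient h g
    integrate sconn g balanced =
      record { to = λ v k → P.potential k v₀ v ; cong = λ {v} {w} v~w k → P.potential-cong k v₀ {v} {w} v~w } ,
      (λ k → P.potential-base k v₀) ,
      λ asc edge k → trans (P.potential-edge k v₀ edge) (form-ascending k asc)
      where
      hor ver : Fin n → ℤ → ℤ → ℤ
      hor k x y = g ((x , y) , east) k
      -- Ascending vertical edges point south, so the edge above `(x , y)` starts at its upper end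
      -- and enters with a minus sign.
      ver k x y = - g ((x , y + 1ℤ) , south) k

      closed : ∀ k {s} → s ∈ R → Form.curl (hor k) (ver k) s ≡ 0ℤ
      closed k {s} s∈R = lem {g (southEdge s) k} {g (westEdge s) k} {g (northEdge s) k} (balanced s∈R k)
        where
        rearrange : ∀ a b c d → a + - d - c - - b ≡ a + b - (c + d)
        rearrange = solve-∀
        lem : ∀ {a b c d} → a + b ≡ c + d → a + - d - c - - b ≡ 0ℤ
        lem {a} {b} {c} {d} eq = trans (rearrange a b c d) (trans (cong (_- (c + d)) eq) (ℤ.+-inverseʳ (c + d)))

      module P k = Potential (hor k) (ver k) R conn sconn (closed k)

      form-ascending : ∀ k {e} → Ascending e → Form.form (hor k) (ver k) e ≡ g e k
      form-ascending k east = refl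
      form-ascending k {(x , y) , _} south =
        trans (ℤ.neg-involutive (g ((x , y - 1ℤ + 1ℤ) , south) k)) (cong (λ z → g ((x , z) , south) k) (-1+1 y))

    -- The difference of the two functions is constant on the corners of each square. It passes to a
    -- neighbouring square at the tail of the common edge, which is the same vertex seen from both
    -- squares.
    gradient-unique : ∀ {g h h′} → Gradient h g → Gradient h′ g →
      (∀ k → (h ⟨$⟩ v₀) k ≡ (h′ ⟨$⟩ v₀) k) → Setoid._≈_ (vertexFunctions n R) h h′
    gradient-unique {g} {h} {h′} ∇h ∇h′ h≗h′ v k = lem {(h ⟨$⟩ v₀) k} (D-walk (conn (square∈R v₀) (square∈R v)) v₀ v refl refl) (h≗h′ k)
      where
      D : Vertex R → ℤ
      D v = (h ⟨$⟩ v) k - (h′ ⟨$⟩ v) k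

      lem : ∀ {a b c d} → a - b ≡ c - d → a ≡ b → c ≡ d
      lem {a} {b} {c} {d} eq refl = ℤ.i-j≡0⇒i≡j c d (trans (sym eq) (ℤ.+-inverseʳ a))

      D-cong : ∀ {v w} → SameVertex R v w → D v ≡ D w
      D-cong v~w = cong₂ _-_ (Func.cong h v~w k) (Func.cong h′ v~w k)

      D-edge : ∀ {e v w} → Ascending e → EdgeFromTo R e v w → D v ≡ D w
      D-edge {_} {v} {w} asc edge = equal {(h ⟨$⟩ w) k} {(h ⟨$⟩ v) k} {(h′ ⟨$⟩ w) k} (trans (∇h asc edge k) (sym (∇h′ asc edge k)))
        where
        rearrange : ∀ a b c d → b - d ≡ a - c - (a - b - (c - d))
        rearrange = solve-∀
        equal : ∀ {a b c d} → a - b ≡ c - d → b - d ≡ a - c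
        equal {a} {b} {c} {d} eq = trans (rearrange a b c d)
          (trans (cong (λ z → a - c - (z - (c - d))) eq)
            (trans (cong (λ z → a - c - z) (ℤ.+-inverseʳ (c - d))) (ℤ.+-identityʳ _)))

      module _ {x y} (s∈R : (x , y) ∈ R) where

        open Corners s∈R

        D-corner : ∀ v → square v ≡ (x , y) → D v ≡ D sw
        D-corner v@(record { point = p , q ; isCorner = inj₁ p≡ , inj₁ q≡ }) refl = D-cong (sameVertex v sw refl (cong₂ _,_ p≡ q≡))
        D-corner v@(record { point = p , q ; isCorner = inj₂ p≡ , inj₁ q≡ }) refl =
          trans (D-cong (sameVertex v se refl (cong₂ _,_ p≡ q≡))) (sym (D-edge east edge-south))
        D-corner v@(record { point = p , q ; isCorner = inj₁ p≡ , inj₂ q≡ }) refl =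
          trans (D-cong (sameVertex v nw refl (cong₂ _,_ p≡ q≡))) (D-edge south edge-west)
        D-corner v@(record { point = p , q ; isCorner = inj₂ p≡ , inj₂ q≡ }) refl =
          trans (D-cong (sameVertex v ne refl (cong₂ _,_ p≡ q≡))) (trans (sym (D-edge east edge-north)) (D-edge south edge-west))

      D-square : ∀ v w → square v ≡ square w → D v ≡ D w
      D-square v w eq = trans (D-corner (square∈R w) v eq) (sym (D-corner (square∈R w) w refl))

      D-walk : ∀ {s t} → Walk (_∈ R) s t → ∀ v w → square v ≡ s → square w ≡ t → D v ≡ D w
      D-walk ε v w refl eq = D-square v w (sym eq)
      D-walk ((s∈R , u∈R , adj) ◅ γ) v w refl eq with adjacent-ascending adj
      ... | e , asc , inj₁ (refl , refl) =
        trans (D-square v (corner s∈R (tail e) (tail-left e)) refl)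
        (trans (D-cong (sameVertex-across e s∈R u∈R (tail-left e) (tail-right e)))
               (D-walk γ (corner u∈R (tail e) (tail-right e)) w refl eq))
      ... | e , asc , inj₂ (refl , refl) =
        trans (D-square v (corner s∈R (tail e) (tail-right e)) refl)
        (trans (sym (D-cong (sameVertex-across e u∈R s∈R (tail-left e) (tail-right e))))
               (D-walk γ (corner u∈R (tail e) (tail-left e)) w refl eq))

-- From tilings to height functions

module _ {n : ℕ} .{{_ : NonZero n}} where

  open Modulo n

  edgeOfType : ∀ {e} → Ascending e → EdgeOfType n (colour n (right e)) e
  edgeOfType asc = record { higherOnLeft = level-ascending asc ; lowerColour = refl ; higherColour = colour-ascending asc }

  crossed+basis : ∀ j c k → crossed n j c k + basis n c k ≡ + 2 * basis n j k
  crossed+basis j c k = lem (+ 2 * basis n j k) (basis n c k)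
    where
    lem : ∀ a b → a - b + b ≡ a
    lem = solve-∀

  basis+basis : ∀ c k → basis n c k + basis n c k ≡ + 2 * basis n c k
  basis+basis c k = lem (basis n c k)
    where
    lem : ∀ b → b + b ≡ + 2 * b
    lem = solve-∀

  open Setoid (tileSetoid n) using () renaming (_≈_ to _≈ₜ_)
  open SetoidMembership (tileSetoid n) using () renaming (_∈_ to _∈ₜ_)
  open Tile using (squares)

  type-unique : ∀ {t u i j} → t ≈ₜ u → TileOfType n i t → TileOfType n j u → i ≡ j
  type-unique (t⊆u , u⊆t) τ υ = trans (sym (highestColour τ)) (trans
    (colour-level (highest τ) (highest υ) (ℤ.≤-antisym (isHighest υ (t⊆u (highest∈t τ))) (isHighest τ (u⊆t (highest∈t υ)))))
    (highestColour υ))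
    where open TileOfType

  module _ {R : List Square} (α : Tiling n R) where

    open Tiling α

    Crossing : OrientedEdge → Set
    Crossing e = ∃[ t ] t ∈ₜ tiles × Crosses n e t

    crossing? : ∀ e → Dec (Crossing e)
    crossing? e with Any.any? (λ t → (left e ∈? squares t) ×-dec (right e ∈? squares t)) tiles
    ... | yes any = let t , t∈ , crosses = find any in
                    yes (t , Any.map (λ { refl → (λ s∈ → s∈) , (λ s∈ → s∈) }) t∈ , crosses)
    ... | no ¬any = no λ (t , t∈ , l∈t , r∈t) → ¬any (Any.map (λ (t⊆u , _) → t⊆u l∈t , t⊆u r∈t) t∈)

    increment : OrientedEdge → Vector ℤ n
    increment e with crossing? e
    ... | yes (t , _) = crossed n (proj₁ (TileShape.tileType n t)) (colour n (right e))
    ... | no _        = basis n (colour n (right e))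

    -- The tile found by `crossing?` may differ from `t` as a list, but both contain `left e`, so
    -- `disjoint` identifies them and their types agree.
    increment-crossed : ∀ {e t j} → t ∈ₜ tiles → Crosses n e t → TileOfType n j t →
                        increment e ≡ crossed n j (colour n (right e))
    increment-crossed {e} {t} t∈ (l∈t , r∈t) τ with crossing? e
    ... | yes (u , u∈ , l∈u , r∈u) = cong (λ j → crossed n j (colour n (right e)))
            (type-unique {u} {t} (disjoint {u} {t} u∈ t∈ l∈u l∈t) (proj₂ (TileShape.tileType n u)) τ)
    ... | no ¬crossing = contradiction (t , t∈ , l∈t , r∈t) ¬crossing

    increment-uncrossed : ∀ {e} → (∀ {t} → t ∈ₜ tiles → ¬ Crosses n e t) → increment e ≡ basis n (colour n (right e))
    increment-uncrossed {e} ¬crosses with crossing? e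
    ... | yes (t , t∈ , crosses) = contradiction crosses (¬crosses {t} t∈)
    ... | no _ = refl

    module _ {t j s} (t∈ : t ∈ₜ tiles) (τ : TileOfType n j t) (s∈t : s ∈ squares t) where

      open TileShape n t

      uncrossed-left : ∀ {e} → left e ≡ s → right e ∉ squares t → increment e ≡ basis n (colour n (right e))
      uncrossed-left refl r∉t = increment-uncrossed λ {u} u∈ (l∈u , r∈u) →
        r∉t (proj₁ (disjoint {u} {t} u∈ t∈ l∈u s∈t) r∈u)

      uncrossed-right : ∀ {e} → right e ≡ s → left e ∉ squares t → increment e ≡ basis n (colour n s)
      uncrossed-right refl l∉t = increment-uncrossed λ {u} u∈ (l∈u , r∈u) →
        l∉t (proj₁ (disjoint {u} {t} u∈ t∈ r∈u s∈t) l∈u)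

      -- The two squares below `s` have the same colour, so the tile contains at most one of them:
      -- if `e` is crossed, `e′` is not, and the two basis terms of that colour cancel.
      increments-below : ∀ {e e′} → Ascending e → Ascending e′ → left e ≡ s → left e′ ≡ s → right e ≢ right e′ →
        right e ∈ squares t → ∀ k → increment e k + increment e′ k ≡ + 2 * basis n j k
      increments-below {e} {e′} asc asc′ refl eq r≢r′ r∈t k = trans
        (cong₂ (λ v w → v k + w k) (increment-crossed {e} {t} t∈ (s∈t , r∈t) τ)
          (trans (uncrossed-left {e′} eq λ r′∈t → r≢r′ (colour-injective r∈t r′∈t same)) (cong (basis n) (sym same))))
        (crossed+basis j (colour n (right e)) k)
        where
        same : colour n (right e) ≡ colour n (right e′)
        same = next-injective (trans (sym (colour-ascending asc)) (trans (cong (colour n) (sym eq)) (colour-ascending asc′)))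

      increments-above : ∀ {e e′} → Ascending e → Ascending e′ → right e ≡ s → right e′ ≡ s → left e ≢ left e′ →
        left e ∈ squares t → ∀ k → increment e k + increment e′ k ≡ + 2 * basis n j k
      increments-above {e} {e′} asc asc′ refl eq l≢l′ l∈t k = trans
        (cong₂ (λ v w → v k + w k) (increment-crossed {e} {t} t∈ (l∈t , s∈t) τ)
          (uncrossed-right {e′} eq λ l′∈t → l≢l′ (colour-injective l∈t l′∈t same)))
        (crossed+basis j (colour n (right e)) k)
        where
        same : colour n (left e) ≡ colour n (left e′)
        same = trans (colour-ascending asc) (trans (cong (λ u → next n (colour n u)) (sym eq)) (sym (colour-ascending asc′)))

      below-sum : ∀ k → increment (southEdge s) k + increment (westEdge s) k ≡ + 2 * basis n j k
      below-sum k with below τ s∈t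
      -- A bottom square has colour `j + 1`, so both squares below it have colour `j`, and each
      -- plain increment is `basis n j`.
      ... | inj₁ bottom = trans (cong₂ (λ v w → v k + w k)
              (plain east refl) (plain south (left-westEdge s))) (basis+basis j k)
        where
        plain : ∀ {e} → Ascending e → left e ≡ s → increment e ≡ basis n j
        plain asc l≡s = trans (uncrossed-left l≡s (≡-next⇒bottom τ s∈t bottom asc l≡s))
          (cong (basis n) (next-injective (trans (sym (colour-ascending asc)) (trans (cong (colour n) l≡s) bottom))))
      ... | inj₂ (e , asc , refl , r∈t) with ascending-left asc
      ...   | inj₁ eq = increments-below east south refl (left-westEdge s) (south≢west s)
                (subst (λ e → right e ∈ squares t) eq r∈t) k
      ...   | inj₂ eq = trans (ℤ.+-comm (increment (southEdge s) k) _)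
              (increments-below south east (left-westEdge s) refl (≢-sym (south≢west s))
                (subst (λ e → right e ∈ squares t) eq r∈t) k)

      above-sum : ∀ k → increment (northEdge s) k + increment (eastEdge s) k ≡ + 2 * basis n j k
      above-sum k with above τ s∈t
      ... | inj₁ top = trans (cong₂ (λ v w → v k + w k)
              (plain east (right-northEdge s)) (plain south (right-eastEdge s))) (basis+basis j k)
        where
        plain : ∀ {e} → Ascending e → right e ≡ s → increment e ≡ basis n j
        plain asc r≡s = trans (uncrossed-right r≡s (≡⇒top τ s∈t top asc r≡s)) (cong (basis n) top)
      ... | inj₂ (e , asc , refl , l∈t) with ascending-right asc
      ...   | inj₁ eq = increments-above east south (right-northEdge s) (right-eastEdge s) (north≢east s)
                (subst (λ e → left e ∈ squares t) eq l∈t) k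
      ...   | inj₂ eq = trans (ℤ.+-comm (increment (northEdge s) k) _)
              (increments-above south east (right-eastEdge s) (right-northEdge s) (≢-sym (north≢east s))
                (subst (λ e → left e ∈ squares t) eq l∈t) k)

    increment-balanced : ∀ {s} → s ∈ R → Balanced {R = R} increment s
    increment-balanced s∈R k with covering s∈R
    ... | t , t∈ , s∈t with TileShape.tileType n t
    ...   | j , τ = trans (below-sum {t} t∈ τ s∈t k) (sym (above-sum {t} t∈ τ s∈t k))

    module _ {v₀ : Vertex R} {h : VertexFunction n R} where

      heightFunction⇒gradient : IsHeightFunction n R v₀ α h → Gradient {R = R} h increment
      heightFunction⇒gradient hf {e} asc edge k with crossing? e
      ... | yes (t , t∈ , crosses) = IsHeightFunction.crossesTile hf {t = t} edge (edgeOfType asc) t∈ crosses (proj₂ (TileShape.tileType n t)) k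
      ... | no ¬crossing = IsHeightFunction.uncrossed hf edge (edgeOfType asc) (λ {t} t∈ crosses → ¬crossing (t , t∈ , crosses)) k

      gradient⇒heightFunction : (∀ k → (h ⟨$⟩ v₀) k ≡ 0ℤ) → Gradient {R = R} h increment → IsHeightFunction n R v₀ α h
      gradient⇒heightFunction base ∇h = record
        { base = base
        ; uncrossed = λ { {e} edge record { higherOnLeft = higher ; lowerColour = refl } ¬crosses k →
            trans (∇h (ascending e higher) edge k) (cong (λ v → v k) (increment-uncrossed λ {t} → ¬crosses {t})) }
        ; crossesTile = λ { {e} {t = t} edge record { higherOnLeft = higher ; lowerColour = refl } t∈ crosses τ k →
            trans (∇h (ascending e higher) edge k) (cong (λ v → v k) (increment-crossed {e} {t} t∈ crosses τ)) }
        }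

      gradient⇒admissible : (∀ k → (h ⟨$⟩ v₀) k ≡ 0ℤ) → Gradient {R = R} h increment → Admissible n R v₀ h
      gradient⇒admissible base ∇h = record
        { base = base
        ; boundary = λ { {e} edge record { higherOnLeft = higher ; lowerColour = refl } bd k →
            trans (∇h (ascending e higher) edge k) (cong (λ v → v k) (increment-uncrossed λ {t} t∈ (l∈t , r∈t) →
              outside bd (within {t} t∈ l∈t) (within {t} t∈ r∈t))) }
        ; interior = λ { {e} edge record { higherOnLeft = higher ; lowerColour = refl } _ → classify (ascending e higher) edge }
        }
        where
        outside : ∀ {e} → Boundary R e → left e ∈ R → right e ∈ R → ⊥
        outside (inj₁ (_ , r∉R)) _ r∈R = r∉R r∈R
        outside (inj₂ (l∉R , _)) l∈R _ = l∉R l∈R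

        -- The type of a crossing tile differs from the colour of `right e`, because only the
        -- highest square of the tile has colour `j` and `left e` lies above `right e`.
        classify : ∀ {e v w} → Ascending e → EdgeFromTo R e v w →
          (∀ k → (h ⟨$⟩ w) k - (h ⟨$⟩ v) k ≡ basis n (colour n (right e)) k) ⊎
          (∃[ j ] j ≢ colour n (right e) × (∀ k → (h ⟨$⟩ w) k - (h ⟨$⟩ v) k ≡ crossed n j (colour n (right e)) k))
        classify {e} asc edge with crossing? e
        ... | no ¬crossing = inj₁ λ k → trans (∇h asc edge k)
          (cong (λ v → v k) (increment-uncrossed λ {t} t∈ crosses → ¬crossing (t , t∈ , crosses)))
        ... | yes (t , t∈ , l∈t , r∈t) with TileShape.tileType n t
        ...   | j , τ = inj₂ (j , (λ j≡c → TileShape.≡⇒top n t τ r∈t (sym j≡c) asc refl l∈t) , λ k →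
          trans (∇h asc edge k) (cong (λ v → v k) (increment-crossed {e} {t} t∈ (l∈t , r∈t) τ)))

module _ {n : ℕ} .{{_ : NonZero n}} where

  open Modulo n
  open Setoid (tileSetoid n) using () renaming (_≈_ to _≈ₜ_; refl to ≈ₜ-refl; trans to ≈ₜ-trans)
  open SetoidMembership (tileSetoid n) using () renaming (_∈_ to _∈ₜ_)
  open Tile using (squares)

  -- Coordinates of the increments

  basis-diagonal : ∀ i → basis n i i ≡ 1ℤ
  basis-diagonal i with i Fin.≟ i
  ... | yes _  = refl
  ... | no i≢i = contradiction refl i≢i

  basis-off-diagonal : ∀ {i k} → i ≢ k → basis n i k ≡ 0ℤ
  basis-off-diagonal {i} {k} i≢k with i Fin.≟ k
  ... | yes i≡k = contradiction i≡k i≢k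
  ... | no _    = refl

  -- The coordinate of the lower colour separates the two kinds of increment: it is 1 on an
  -- uncrossed edge and -1 on a crossed one.
  crossed-diagonal : ∀ {j i} → j ≢ i → crossed n j i i ≡ -1ℤ
  crossed-diagonal {j} {i} j≢i rewrite basis-off-diagonal j≢i | basis-diagonal i = refl

  2basis-values : ∀ i k → + 2 * basis n i k ≡ + 0 ⊎ + 2 * basis n i k ≡ + 2
  2basis-values i k with i Fin.≟ k
  ... | yes _ = inj₂ refl
  ... | no _  = inj₁ refl

  2basis-injective : ∀ {i j} → (∀ k → + 2 * basis n i k ≡ + 2 * basis n j k) → i ≡ j
  2basis-injective {i} {j} eq with j Fin.≟ i
  ... | yes j≡i = sym j≡i
  ... | no j≢i with () ← trans (sym (cong (+ 2 *_) (basis-diagonal i)))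
                              (trans (eq i) (cong (+ 2 *_) (basis-off-diagonal j≢i)))

  -- Here 1 is congruent to 0, so `n` is 1. This covers the degenerate case in which the lower and
  -- upper edges of a square have the same type.
  next-fixed : ∀ {i} → next n i ≡ i → ∀ j → j ≡ i
  next-fixed {i} fixed j with 1 ℕ.<? n
  ... | no n≤1 = Fin.toℕ-injective (trans (small j) (sym (small i)))
    where
    small : ∀ (k : Fin n) → toℕ k ≡ 0
    small k = ℕ.n<1⇒n≡0 (ℕ.<-≤-trans (Fin.toℕ<n k) (ℕ.≮⇒≥ n≤1))
  ... | yes 1<n = contradiction (remainder-unique 1<n (ℕ.>-nonZero⁻¹ n)
    (∼-trans (≡⇒∼ (lem (+ toℕ i))) (∼-trans (∼-+ (- + toℕ i) 1∼0) (≡⇒∼ (ℤ.+-inverseʳ (+ toℕ i)))))) λ ()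
    where
    1∼0 : + toℕ i + 1ℤ ∼ + toℕ i
    1∼0 = ∼-trans (∼-sym (next-∼ i)) (≡⇒∼ (cong (λ k → + toℕ k) fixed))
    lem : ∀ z → 1ℤ ≡ z + 1ℤ - z
    lem = solve-∀

  -- Tilings are determined by their height functions

  module _ {R : List Square} where

    module _ (α : Tiling n R) where

      open Tiling α

      increment-crossing : ∀ {e} → Ascending e → Crossing α e → increment α e (colour n (right e)) ≡ -1ℤ
      increment-crossing {e} asc (t , t∈ , l∈t , r∈t) with TileShape.tileType n t
      ... | j , τ = trans (cong (λ v → v (colour n (right e))) (increment-crossed α {e} {t} t∈ (l∈t , r∈t) τ))
        (crossed-diagonal λ j≡c → TileShape.≡⇒top n t τ r∈t (sym j≡c) asc refl l∈t)

      crossing-increment : ∀ {e} → increment α e (colour n (right e)) ≡ -1ℤ → Crossing α e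
      crossing-increment {e} eq with crossing? α e
      ... | yes crossing = crossing
      ... | no ¬crossing with () ← trans (sym (basis-diagonal (colour n (right e)))) eq

      increment-cong : ∀ (β : Tiling n R) → Setoid._≈_ (tilingSetoid n R) α β → ∀ e → increment α e ≡ increment β e
      increment-cong β (α⊆β , β⊆α) e with crossing? α e
      ... | yes (t , t∈α , crosses) = sym (increment-crossed β {e} {t} (α⊆β {t} t∈α) crosses (proj₂ (TileShape.tileType n t)))
      ... | no ¬crossing = sym (increment-uncrossed β λ {t} t∈β crosses → ¬crossing (t , β⊆α {t} t∈β , crosses))

    module _ (α β : Tiling n R) (crossing⊆ : ∀ {e} → Ascending e → Crossing α e → Crossing β e) where

      open Tiling

      -- Membership in `u` spreads along walks in `t`: each step passes an edge crossed in `α`,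
      -- hence crossed by some tile of `β`, and that tile meets `u`, so it is `u`.
      tile⊆ : ∀ {t u s} → t ∈ₜ tiles α → u ∈ₜ tiles β → s ∈ squares t → s ∈ squares u →
              ∀ {s′} → s′ ∈ squares t → s′ ∈ squares u
      tile⊆ {t} {u} t∈α u∈β s∈t s∈u s′∈t = go (Tile.connected t s∈t s′∈t) s∈u
        where
        step : ∀ {s s′} → s ∈ squares t → s′ ∈ squares t → Adjacent s s′ → s ∈ squares u → s′ ∈ squares u
        step s∈t s′∈t adj s∈u with adjacent-ascending adj
        ... | e , asc , inj₁ (refl , refl) with crossing⊆ asc (t , t∈α , s∈t , s′∈t)
        ...   | w , w∈β , l∈w , r∈w = proj₁ (disjoint β {w} {u} w∈β u∈β l∈w s∈u) r∈w
        step s∈t s′∈t adj s∈u | e , asc , inj₂ (refl , refl) with crossing⊆ asc (t , t∈α , s′∈t , s∈t)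
        ...   | w , w∈β , l∈w , r∈w = proj₁ (disjoint β {w} {u} w∈β u∈β r∈w s∈u) l∈w
        go : ∀ {s s′} → Walk (_∈ squares t) s s′ → s ∈ squares u → s′ ∈ squares u
        go ε s∈u = s∈u
        go ((s∈t , s′∈t , adj) ◅ γ) s∈u = go γ (step s∈t s′∈t adj s∈u)

    tiles⊆ : (α β : Tiling n R) → (∀ {e} → Ascending e → Crossing α e → Crossing β e) →
             (∀ {e} → Ascending e → Crossing β e → Crossing α e) →
             ∀ {t} → t ∈ₜ Tiling.tiles α → t ∈ₜ Tiling.tiles β
    tiles⊆ α β α⊆β β⊆α {t} t∈α with TileShape.tileType n t
    -- The lowest square is just a convenient square of `t`; it selects the tile of `β` to compare
    -- with.
    ... | _ , τ with Tiling.covering β (Tiling.within α {t} t∈α (TileOfType.lowest∈t τ))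
    ...   | u , u∈β , l∈u = Any.map (λ {w} → ≈ₜ-trans {t} {u} {w} t≈u) u∈β
      where
      l∈t = TileOfType.lowest∈t τ
      t≈u : t ≈ₜ u
      t≈u = tile⊆ α β α⊆β {t} {u} t∈α u∈β l∈t l∈u , tile⊆ β α β⊆α {u} {t} u∈β t∈α l∈u l∈t

    gradient-injective : ∀ (α β : Tiling n R) {h h′} → Gradient {R = R} h (increment α) → Gradient {R = R} h′ (increment β) →
      Setoid._≈_ (vertexFunctions n R) h h′ → Setoid._≈_ (tilingSetoid n R) α β
    gradient-injective α β {h} {h′} ∇h ∇h′ h≈h′ =
      (λ {t} → tiles⊆ α β α⊆β β⊆α {t}) , (λ {t} → tiles⊆ β α β⊆α α⊆β {t})
      where
      same : ∀ {e} → Ascending e → left e ∈ R → ∀ k → increment α e k ≡ increment β e k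
      same {e} asc l∈R k = trans (sym (∇h asc edge k)) (trans (cong₂ _-_ (h≈h′ w k) (h≈h′ v k)) (∇h′ asc edge k))
        where
        v = corner l∈R (tail e) (tail-left e)
        w = corner l∈R (head e) (head-left e)
        edge : EdgeFromTo R e v w
        edge = record { sameSquare = refl ; incident = inj₁ refl ; from = refl ; to = refl }
      α⊆β : ∀ {e} → Ascending e → Crossing α e → Crossing β e
      α⊆β {e} asc c@(t , t∈ , l∈t , _) = crossing-increment β
        (trans (sym (same asc (Tiling.within α {t} t∈ l∈t) _)) (increment-crossing α asc c))
      β⊆α : ∀ {e} → Ascending e → Crossing β e → Crossing α e
      β⊆α {e} asc c@(t , t∈ , l∈t , _) = crossing-increment α
        (trans (same asc (Tiling.within β {t} t∈ l∈t) _) (increment-crossing β asc c))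

  -- The number of steps from the lowest square of a tile of type (j , j + 1) to a square of level z.
  offset : Fin n → ℤ → ℕ
  offset j z = (z - + suc (toℕ j)) %ℕ n

  offset<n : ∀ j z → offset j z ℕ.< n
  offset<n j z = n%ℕd<d (z - + suc (toℕ j)) n

  offset-∼ : ∀ j z → z ∼ + suc (toℕ j) + + offset j z
  offset-∼ j z = ∼-trans (≡⇒∼ (lem z (+ suc (toℕ j))))
    (∼-trans (∼-+ (+ suc (toℕ j)) (%ℕ-∼ (z - + suc (toℕ j)))) (≡⇒∼ (ℤ.+-comm (+ offset j z) (+ suc (toℕ j)))))
    where
    lem : ∀ z a → z ≡ z - a + a
    lem = solve-∀

  offset-unique : ∀ j z {k} → k ℕ.< n → z ∼ + suc (toℕ j) + + k → offset j z ≡ k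
  offset-unique j z {k} k<n z∼ = %ℕ-unique k<n (∼-trans (∼-+ (- + suc (toℕ j)) z∼) (≡⇒∼ (lem (+ suc (toℕ j)) (+ k))))
    where
    lem : ∀ a k → a + k - a ≡ k
    lem = solve-∀

  +suc : ∀ z k → z + + suc k ≡ z + + k + 1ℤ
  +suc z k = trans (cong (λ i → z + + i) (ℕ.+-comm 1 k)) (sym (ℤ.+-assoc z (+ k) 1ℤ))

  offset-+1 : ∀ j z {k} → offset j z ≡ k → suc k ℕ.< n → offset j (z + 1ℤ) ≡ suc k
  offset-+1 j z {k} refl k<n = offset-unique j (z + 1ℤ) k<n
    (∼-trans (∼-+ 1ℤ (offset-∼ j z)) (≡⇒∼ (sym (+suc (+ suc (toℕ j)) k))))

  offset--1 : ∀ j z {k} → offset j (z + 1ℤ) ≡ suc k → offset j z ≡ k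
  offset--1 j z {k} eq = offset-unique j z (ℕ.<-trans (ℕ.n<1+n k) (subst (ℕ._< n) eq (offset<n j (z + 1ℤ))))
    (∼-trans (≡⇒∼ (sym (+1-1 z))) (∼-trans (∼-+ (- 1ℤ) (offset-∼ j (z + 1ℤ)))
      (≡⇒∼ (trans (cong (λ i → + suc (toℕ j) + + i - 1ℤ) eq) (trans (cong (_- 1ℤ) (+suc (+ suc (toℕ j)) k)) (+1-1 _))))))

  offset-zero : ∀ j s → colour n s ≡ next n j → offset j (level s) ≡ 0
  offset-zero j s eq = offset-unique j (level s) (ℕ.>-nonZero⁻¹ n) (∼-trans (≡-colour s eq) (∼-trans (next-∼ j)
    (≡⇒∼ (trans (cong +_ (ℕ.+-comm (toℕ j) 1)) (sym (ℤ.+-identityʳ _))))))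

  zero-offset : ∀ j s → offset j (level s) ≡ 0 → colour n s ≡ next n j
  zero-offset j s eq = colour-≡ s (∼-trans (offset-∼ j (level s))
    (∼-trans (≡⇒∼ (trans (cong (λ i → + suc (toℕ j) + + i) eq) (trans (ℤ.+-identityʳ _) (cong +_ (ℕ.+-comm 1 (toℕ j))))))
      (∼-sym (next-∼ j))))

  -- The colour is that of `j + 1 + (n - 1)`, which is `j + n`.
  offset-last : ∀ j s → suc (offset j (level s)) ≡ n → colour n s ≡ j
  offset-last j s eq = colour-≡ s (∼-trans (offset-∼ j (level s))
    (∼-trans (≡⇒∼ (trans (cong +_ (sym (ℕ.+-suc (toℕ j) (offset j (level s))))) (cong (λ m → + (toℕ j ℕ.+ m)) eq))) (+n-∼ (+ toℕ j))))

  last-offset : ∀ j s → colour n s ≡ j → ¬ suc (offset j (level s)) ℕ.< n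
  last-offset j s eq o<n = contradiction (remainder-unique o<n (ℕ.>-nonZero⁻¹ n)
    (∼-trans (≡⇒∼ (lem (+ toℕ j) (+ suc o) (+ suc (toℕ j) + + o) (cong +_ (sym (ℕ.+-suc (toℕ j) o)))))
    (∼-trans (∼-+ (- + toℕ j) (∼-trans (∼-sym (offset-∼ j (level s))) (≡-colour s eq)))
    (≡⇒∼ (ℤ.+-inverseʳ (+ toℕ j)))))) λ ()
    where
    o = offset j (level s)
    cancel : ∀ a b → b ≡ a + b - a
    cancel = solve-∀
    lem : ∀ a b c → c ≡ a + b → b ≡ c - a
    lem a b .(a + b) refl = cancel a b

  offset-≢ : ∀ j s → colour n s ≢ j → suc (offset j (level s)) ℕ.< n
  offset-≢ j s s≢j = ℕ.≤∧≢⇒< (offset<n j (level s)) λ eq → s≢j (offset-last j s eq)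

  -- From height functions to tilings

  module FromIncrements {R : List Square} (g : OrientedEdge → Vector ℤ n) where

    -- The field `j≢` is what separates marked from plain edges: for `j` equal to the lower colour,
    -- `crossed` would coincide with `basis`.
    record Marked (e : OrientedEdge) (j : Fin n) : Set where
      field
        left∈R  : left e ∈ R
        right∈R : right e ∈ R
        j≢      : j ≢ colour n (right e)
        value   : ∀ k → g e k ≡ crossed n j (colour n (right e)) k

    Plain : OrientedEdge → Set
    Plain e = ∀ k → g e k ≡ basis n (colour n (right e)) k

    marked-value : ∀ {e j} → Marked e j → g e (colour n (right e)) ≡ -1ℤ
    marked-value marked = trans (Marked.value marked _) (crossed-diagonal (Marked.j≢ marked))

    plain-value : ∀ {e} → Plain e → g e (colour n (right e)) ≡ 1ℤ
    plain-value {e} plain = trans (plain (colour n (right e))) (basis-diagonal (colour n (right e)))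

    plain⇒¬marked : ∀ {e j} → Plain e → ¬ Marked e j
    plain⇒¬marked plain marked with () ← trans (sym (plain-value plain)) (marked-value marked)

    marked-unique : ∀ {e i j} → Marked e i → Marked e j → i ≡ j
    marked-unique {e} {i} {j} p q = 2basis-injective λ k →
      +-cancelʳ (- basis n (colour n (right e)) k) _ _ (trans (sym (Marked.value p k)) (Marked.value q k))

    -- e and e′ are both lower or both upper edges of a square; c is the colour of their lower
    -- squares and j the type of the tile.
    data Pair (e e′ : OrientedEdge) (c j : Fin n) : Set where
      neither : Plain e → Plain e′ → c ≡ j → Pair e e′ c j
      first   : Marked e j → Plain e′ → Pair e e′ c j
      second  : Plain e → Marked e′ j → Pair e e′ c j

    module _ {e e′ c} (e-colour : colour n (right e) ≡ c) (e′-colour : colour n (right e′) ≡ c) where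

      pair-sum : ∀ {j} → Pair e e′ c j → ∀ k → g e k + g e′ k ≡ + 2 * basis n j k
      pair-sum (neither p p′ refl) k rewrite p k | p′ k | e-colour | e′-colour = basis+basis c k
      pair-sum {j} (first m p) k rewrite Marked.value m k | p k | e-colour | e′-colour = crossed+basis j c k
      pair-sum {j} (second p m) k rewrite Marked.value m k | p k | e-colour | e′-colour =
        trans (ℤ.+-comm (basis n c k) (crossed n j c k)) (crossed+basis j c k)

      BothMarked : Set
      BothMarked = ∃[ i ] ∃[ j ] Marked e i × Marked e′ j

      both-diagonal : BothMarked → g e c + g e′ c ≡ - + 2
      both-diagonal (i , j , m , m′) = cong₂ _+_
        (subst (λ c → g e c ≡ -1ℤ) e-colour (marked-value m)) (subst (λ c → g e′ c ≡ -1ℤ) e′-colour (marked-value m′))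

      both-off-diagonal : BothMarked → ∀ {k} → c ≢ k → g e k + g e′ k ≢ - + 2
      both-off-diagonal (i , j , m , m′) {k} c≢k eq
        with trans (sym eq) (cong₂ _+_ (value m e-colour) (value m′ e′-colour))
        where
        value : ∀ {e j} → Marked e j → colour n (right e) ≡ c → g e k ≡ + 2 * basis n j k
        value {j = j} m refl = trans (Marked.value m k)
          (trans (cong (λ z → + 2 * basis n j k - z) (basis-off-diagonal c≢k)) (ℤ.+-identityʳ _))
      ... | sum with + 2 * basis n i k | 2basis-values i k | + 2 * basis n j k | 2basis-values j k
      both-off-diagonal _ _ _ | () | _ | inj₁ refl | _ | inj₁ refl
      both-off-diagonal _ _ _ | () | _ | inj₁ refl | _ | inj₂ refl
      both-off-diagonal _ _ _ | () | _ | inj₂ refl | _ | inj₁ refl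
      both-off-diagonal _ _ _ | () | _ | inj₂ refl | _ | inj₂ refl

      pair-or-both : Plain e ⊎ ∃ (Marked e) → Plain e′ ⊎ ∃ (Marked e′) → ∃ (Pair e e′ c) ⊎ BothMarked
      pair-or-both (inj₁ p)       (inj₁ p′)        = inj₁ (c , neither p p′ refl)
      pair-or-both (inj₁ p)       (inj₂ (j , m′))  = inj₁ (j , second p m′)
      pair-or-both (inj₂ (i , m)) (inj₁ p′)        = inj₁ (i , first m p′)
      pair-or-both (inj₂ (i , m)) (inj₂ (j , m′))  = inj₂ (i , j , m , m′)

    module Construct
      (balanced : ∀ {s} → s ∈ R → Balanced {R = R} g s)
      (classify : ∀ {e} → Ascending e → left e ∈ R ⊎ right e ∈ R → Plain e ⊎ ∃ (Marked e)) where

      -- The lower sum alone determines `j`, by `2basis-injective`; balance makes the upper sum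
      -- equally good evidence, as `above-typed` shows.
      record Typed (s : Square) (j : Fin n) : Set where
        field
          member : s ∈ R
          sum    : ∀ k → g (southEdge s) k + g (westEdge s) k ≡ + 2 * basis n j k

      typed-unique : ∀ {s i j} → Typed s i → Typed s j → i ≡ j
      typed-unique τ υ = 2basis-injective λ k → trans (sym (Typed.sum τ k)) (Typed.sum υ k)

      BelowPair AbovePair : Square → Fin n → Set
      BelowPair s = Pair (southEdge s) (westEdge s) (colour n (right (southEdge s)))
      AbovePair s = Pair (northEdge s) (eastEdge s) (colour n s)

      west-colour : ∀ s → colour n (right (westEdge s)) ≡ colour n (right (southEdge s))
      west-colour s = next-injective (trans (sym (colour-ascending {westEdge s} south))
        (trans (cong (colour n) (left-westEdge s)) (colour-ascending {southEdge s} east)))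

      below-typed : ∀ {s j} → s ∈ R → BelowPair s j → Typed s j
      below-typed {s} s∈R pair = record { member = s∈R ; sum = pair-sum refl (west-colour s) pair }

      above-typed : ∀ {s j} → s ∈ R → AbovePair s j → Typed s j
      above-typed {s} s∈R pair = record { member = s∈R ; sum = λ k → trans (balanced s∈R k)
        (pair-sum (cong (colour n) (right-northEdge s)) (cong (colour n) (right-eastEdge s)) pair k) }

      2basis≢-2 : ∀ {j k z} → z ≡ + 2 * basis n j k → z ≢ - + 2
      2basis≢-2 {j} {k} refl eq with + 2 * basis n j k | 2basis-values j k
      2basis≢-2 refl () | _ | inj₁ refl
      2basis≢-2 refl () | _ | inj₂ refl

      -- Two marked edges of a pair put -2 into the coordinate of their lower colour and 0, 2 or 4
      -- into every other one. A pair with at most one mark sums to `2e_j` and has no negative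
      -- coordinate. So balance forbids two marks in just one pair, and two marks in both pairs if
      -- their lower colours `c` and `c′` differ.
      pairs : ∀ {s} → s ∈ R → ∃[ j ] BelowPair s j × AbovePair s j
      pairs {s} s∈R = go
        (pair-or-both refl (west-colour s)
          (classify {southEdge s} east (inj₁ s∈R))
          (classify {westEdge s} south (inj₁ (subst (_∈ R) (sym (left-westEdge s)) s∈R))))
        (pair-or-both north-colour east-colour
          (classify {northEdge s} east (inj₂ (subst (_∈ R) (sym (right-northEdge s)) s∈R)))
          (classify {eastEdge s} south (inj₂ (subst (_∈ R) (sym (right-eastEdge s)) s∈R))))
        where
        c c′ : Fin n
        c  = colour n (right (southEdge s))
        c′ = colour n s
        north-colour : colour n (right (northEdge s)) ≡ c′
        north-colour = cong (colour n) (right-northEdge s)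
        east-colour : colour n (right (eastEdge s)) ≡ c′
        east-colour = cong (colour n) (right-eastEdge s)
        go : ∃ (BelowPair s) ⊎ BothMarked {southEdge s} {westEdge s} {c} refl (west-colour s) →
             ∃ (AbovePair s) ⊎ BothMarked {northEdge s} {eastEdge s} {c′} north-colour east-colour →
             ∃[ j ] BelowPair s j × AbovePair s j
        go (inj₁ (i , below)) (inj₁ (j , above)) = i , below ,
          subst (AbovePair s) (typed-unique (above-typed s∈R above) (below-typed s∈R below)) above
        go (inj₁ (i , below)) (inj₂ both) = ⊥-elim (2basis≢-2 {i} {c′}
          (trans (sym (balanced s∈R c′)) (Typed.sum (below-typed s∈R below) c′)) (both-diagonal north-colour east-colour both))
        go (inj₂ both) (inj₁ (j , above)) = ⊥-elim (2basis≢-2 {j} {c}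
          (Typed.sum (above-typed s∈R above) c) (both-diagonal refl (west-colour s) both))
        go (inj₂ both@(i , _ , m , _)) (inj₂ both′) with c′ Fin.≟ c
        -- The colour `c` is its own successor, so there is only one colour and no `j` is left for a
        -- marked edge.
        ... | yes c′≡c = ⊥-elim (Marked.j≢ m (next-fixed (trans (sym (colour-ascending {southEdge s} east)) c′≡c) i))
        ... | no  c′≢c = ⊥-elim (both-off-diagonal north-colour east-colour both′ c′≢c
          (trans (sym (balanced s∈R c)) (both-diagonal refl (west-colour s) both)))

      typeOf : ∀ {s} → s ∈ R → ∃ (Typed s)
      typeOf s∈R = let j , below , _ = pairs s∈R in j , below-typed s∈R below

      belowPair : ∀ {s j} → Typed s j → BelowPair s j
      belowPair {s} τ = let _ , below , _ = pairs (Typed.member τ) in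
        subst (BelowPair s) (typed-unique (below-typed (Typed.member τ) below) τ) below

      abovePair : ∀ {s j} → Typed s j → AbovePair s j
      abovePair {s} τ = let _ , _ , above = pairs (Typed.member τ) in
        subst (AbovePair s) (typed-unique (above-typed (Typed.member τ) above) τ) above

      -- Tested by the sign from `crossed-diagonal`, so that `up` and `down` are total functions on
      -- squares without membership proofs. If neither edge is marked, the second is a meaningless
      -- default.
      choose : OrientedEdge → OrientedEdge → OrientedEdge
      choose e e′ = if does (g e (colour n (right e)) ≟ -1ℤ) then e else e′

      choose-first : ∀ {e e′ j} → Marked e j → choose e e′ ≡ e
      choose-first {e} m with g e (colour n (right e)) ≟ -1ℤ
      ... | yes _  = refl
      ... | no ≢-1 = contradiction (marked-value m) ≢-1

      choose-second : ∀ {e e′} → Plain e → choose e e′ ≡ e′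
      choose-second {e} p with g e (colour n (right e)) ≟ -1ℤ
      ... | yes ≡-1 with () ← trans (sym (plain-value p)) ≡-1
      choose-second {e} p | no _ = refl

      choose-pair : ∀ {e e′ c j} → Pair e e′ c j → c ≢ j → Marked (choose e e′) j
      choose-pair (neither _ _ c≡j) c≢j = contradiction c≡j c≢j
      choose-pair {e} {e′} (first m _)  _ = subst (λ e → Marked e _) (sym (choose-first {e} {e′} m)) m
      choose-pair {e} {e′} (second p m) _ = subst (λ e → Marked e _) (sym (choose-second {e} {e′} p)) m

      choose-marked : ∀ {e e′ d c i j} → Pair e e′ c j → d ≡ e ⊎ d ≡ e′ → Marked d i → choose e e′ ≡ d × j ≡ i
      choose-marked (neither p _ _)  (inj₁ refl) m = contradiction m (plain⇒¬marked p)
      choose-marked (neither _ p′ _) (inj₂ refl) m = contradiction m (plain⇒¬marked p′)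
      choose-marked {e} {e′} (first m′ _) (inj₁ refl) m = choose-first {e} {e′} m , marked-unique m′ m
      choose-marked (first _ p′)  (inj₂ refl) m = contradiction m (plain⇒¬marked p′)
      choose-marked (second p _)  (inj₁ refl) m = contradiction m (plain⇒¬marked p)
      choose-marked {e} {e′} (second p m′) (inj₂ refl) m = choose-second {e} {e′} p , marked-unique m′ m

      choose-either : ∀ {P : OrientedEdge → Set} {e e′} → P e → P e′ → P (choose e e′)
      choose-either {e = e} Pe Pe′ with does (g e (colour n (right e)) ≟ -1ℤ)
      ... | true  = Pe
      ... | false = Pe′

      upEdge downEdge : Square → OrientedEdge
      upEdge s   = choose (northEdge s) (eastEdge s)
      downEdge s = choose (southEdge s) (westEdge s)

      up down : Square → Square
      up s   = left (upEdge s)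
      down s = right (downEdge s)

      upEdge-ascending : ∀ s → Ascending (upEdge s)
      upEdge-ascending s = choose-either {Ascending} {northEdge s} {eastEdge s} east south

      downEdge-ascending : ∀ s → Ascending (downEdge s)
      downEdge-ascending s = choose-either {Ascending} {southEdge s} {westEdge s} east south

      right-upEdge : ∀ s → right (upEdge s) ≡ s
      right-upEdge s = choose-either {λ e → right e ≡ s} {northEdge s} {eastEdge s} (right-northEdge s) (right-eastEdge s)

      left-downEdge : ∀ s → left (downEdge s) ≡ s
      left-downEdge s = choose-either {λ e → left e ≡ s} {southEdge s} {westEdge s} refl (left-westEdge s)

      module _ {e j} (asc : Ascending e) (m : Marked e j) where

        -- At most one lower edge of `left e` is marked, so `e` is the one chosen there. Together
        -- with `marked-right` this makes `up` and `down` inverse to each other along marked edges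
        -- and carries the type across.
        marked-left : downEdge (left e) ≡ e × Typed (left e) j
        marked-left = go (typeOf (Marked.left∈R m))
          where
          go : ∃ (Typed (left e)) → downEdge (left e) ≡ e × Typed (left e) j
          go (i , τ) =
            let eq , i≡j = choose-marked {southEdge (left e)} {westEdge (left e)} {e}
                             (belowPair τ) (ascending-left asc) m
            in eq , subst (Typed (left e)) i≡j τ

        marked-right : upEdge (right e) ≡ e × Typed (right e) j
        marked-right = go (typeOf (Marked.right∈R m))
          where
          go : ∃ (Typed (right e)) → upEdge (right e) ≡ e × Typed (right e) j
          go (i , τ) =
            let eq , i≡j = choose-marked {northEdge (right e)} {eastEdge (right e)} {e}
                             (abovePair τ) (ascending-right asc) m
            in eq , subst (Typed (right e)) i≡j τ

      upEdge-marked : ∀ {s j} → Typed s j → colour n s ≢ j → Marked (upEdge s) j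
      upEdge-marked τ = choose-pair (abovePair τ)

      downEdge-marked : ∀ {s j} → Typed s j → colour n s ≢ next n j → Marked (downEdge s) j
      downEdge-marked {s} τ s≢ = choose-pair (belowPair τ) λ c≡j →
        s≢ (trans (colour-ascending {southEdge s} east) (cong (next n) c≡j))

      up-typed : ∀ {s j} → Typed s j → colour n s ≢ j → Typed (up s) j × down (up s) ≡ s
      up-typed {s} τ s≢j = let eq , υ = marked-left (upEdge-ascending s) (upEdge-marked τ s≢j) in
        υ , trans (cong right eq) (right-upEdge s)

      down-typed : ∀ {s j} → Typed s j → colour n s ≢ next n j → Typed (down s) j × up (down s) ≡ s
      down-typed {s} τ s≢ = let eq , υ = marked-right (downEdge-ascending s) (downEdge-marked τ s≢) in
        υ , trans (cong left eq) (left-downEdge s)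

      up-level : ∀ s → level (up s) ≡ level s + 1ℤ
      up-level s = trans (level-ascending (upEdge-ascending s)) (cong (λ u → level u + 1ℤ) (right-upEdge s))

      down-level : ∀ s → level s ≡ level (down s) + 1ℤ
      down-level s = trans (cong level (sym (left-downEdge s))) (level-ascending (downEdge-ascending s))

      climb : ℕ → Square → Square
      climb zero    s = s
      climb (suc k) s = up (climb k s)

      -- The recursion takes its first step at the argument, opposite to `climb`:
      -- `descend (suc k) (up u)` reduces to `descend k (down (up u))`, where `down` meets the last
      -- `up`.
      descend : ℕ → Square → Square
      descend zero    s = s
      descend (suc k) s = descend k (down s)

      column : Square → List Square
      column s = applyUpTo (λ k → climb k s) n

      record Bottom (s : Square) (j : Fin n) : Set where
        field
          typed  : Typed s j
          bottom : offset j (level s) ≡ 0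

      record Climbed (s : Square) (j : Fin n) (k : ℕ) : Set where
        field
          typed   : Typed (climb k s) j
          offset≡ : offset j (level (climb k s)) ≡ k
          level≡  : level (climb k s) ≡ level s + + k
          descend≡ : descend k (climb k s) ≡ s

      climbed≢ : ∀ {s j k} → Climbed s j k → suc k ℕ.< n → colour n (climb k s) ≢ j
      climbed≢ {s} {j} {k} c k<n eq =
        last-offset j (climb k s) eq (subst (λ i → suc i ℕ.< n) (sym (Climbed.offset≡ c)) k<n)

      -- As long as `suc k < n`, the square reached does not have colour `j`, so one of its upper
      -- edges is marked and the climb continues with the same type.
      climbed : ∀ {s j} → Bottom s j → ∀ {k} → k ℕ.< n → Climbed s j k
      climbed {s} b {zero} _ = record
        { typed = Bottom.typed b
        ; offset≡ = Bottom.bottom b ; level≡ = sym (ℤ.+-identityʳ (level s)) ; descend≡ = refl }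
      climbed {s} {j} b {suc k} k<n = record
        { typed = proj₁ u
        ; offset≡ = trans (cong (offset j) (up-level (climb k s))) (offset-+1 j (level (climb k s)) (Climbed.offset≡ c) k<n)
        ; level≡ = trans (up-level (climb k s)) (trans (cong (_+ 1ℤ) (Climbed.level≡ c)) (sym (+suc (level s) k)))
        ; descend≡ = trans (cong (descend k) (proj₂ u)) (Climbed.descend≡ c) }
        where
        c = climbed b (ℕ.<-trans (ℕ.n<1+n k) k<n)
        u = up-typed (Climbed.typed c) (climbed≢ c k<n)

      -- The offset counts the remaining steps: while it is positive, the colour is not `j + 1`, so
      -- one of the lower edges is marked.
      descended : ∀ {j} k {s} → Typed s j → offset j (level s) ≡ k → Bottom (descend k s) j × climb k (descend k s) ≡ s
      descended zero τ eq = record { typed = τ ; bottom = eq } , refl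
      descended {j} (suc k) {s} τ eq = let b , climb≡ = descended k (proj₁ d) (offset--1 j (level (down s)) (trans (cong (offset j) (sym (down-level s))) eq)) in
        b , trans (cong up climb≡) (proj₂ d)
        where
        d = down-typed τ λ s-colour → ℕ.1+n≢0 (trans (sym eq) (offset-zero j s s-colour))

      module _ {s j} (b : Bottom s j) where

        column⁺ : ∀ {k} → k ℕ.< n → climb k s ∈ column s
        column⁺ = ∈-applyUpTo⁺ (λ k → climb k s)

        -- The start of a column is recovered from any of its squares, by descending as often as the
        -- offset says. Hence columns that share a square have the same start.
        column⁻ : ∀ {u} → u ∈ column s → Typed u j × descend (offset j (level u)) u ≡ s × climb (offset j (level u)) s ≡ u
        column⁻ u∈ with ∈-applyUpTo⁻ (λ k → climb k s) u∈
        ... | k , k<n , refl = Climbed.typed c ,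
          trans (cong (λ i → descend i (climb k s)) (Climbed.offset≡ c)) (Climbed.descend≡ c) ,
          cong (λ i → climb i s) (Climbed.offset≡ c)
          where c = climbed b k<n

        column-walk : ∀ {k} → k ℕ.< n → Walk (_∈ column s) s (climb k s)
        column-walk {zero} _ = ε
        column-walk {suc k} k<n = column-walk k<n′ ◅◅
          (column⁺ k<n′ , column⁺ k<n , upEdge (climb k s) , inj₂ (refl , right-upEdge (climb k s))) ◅ ε
          where k<n′ = ℕ.<-trans (ℕ.n<1+n k) k<n

        column-tile : Tile n
        column-tile = record
          { squares = column s
          ; connected = λ u∈ w∈ → Walk-sym (walk-to u∈) ◅◅ walk-to w∈
          ; colours = λ c → climb (k c) s , (column⁺ (k<n c) , colour-climb c) , unique c
          }
          where
          walk-to : ∀ {u} → u ∈ column s → Walk (_∈ column s) s u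
          walk-to u∈ with ∈-applyUpTo⁻ (λ k → climb k s) u∈
          ... | k , k<n , refl = column-walk k<n
          k : Fin n → ℕ
          -- The number `toℕ c` serves as a level of colour `c`, so this is the height at which the
          -- column meets that colour.
          k c = offset j (+ toℕ c)
          k<n : ∀ c → k c ℕ.< n
          k<n c = offset<n j (+ toℕ c)
          colour-climb : ∀ c → colour n (climb (k c) s) ≡ c
          colour-climb c = colour-≡ (climb (k c) s) (∼-trans (offset-∼ j (level (climb (k c) s)))
            (∼-trans (≡⇒∼ (cong (λ i → + suc (toℕ j) + + i) (Climbed.offset≡ (climbed b (k<n c)))))
              (∼-sym (offset-∼ j (+ toℕ c)))))
          unique : ∀ c {u} → u ∈ column s × colour n u ≡ c → climb (k c) s ≡ u
          unique c {u} (u∈ , refl) = trans (cong (λ i → climb i s) (sym same)) (proj₂ (proj₂ (column⁻ u∈)))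
            where
            same : offset j (level u) ≡ k c
            same = offset-unique j (level u) (k<n c) (∼-trans (colour-∼ u) (offset-∼ j (+ toℕ c)))

        column-type : TileOfType n j column-tile
        column-type = record
          { lowest = s ; highest = climb m s
          ; lowest∈t = column⁺ (ℕ.>-nonZero⁻¹ n) ; highest∈t = column⁺ m<n
          ; isLowest = λ u∈ → is-lowest (∈-applyUpTo⁻ (λ k → climb k s) u∈)
          ; isHighest = λ u∈ → is-highest (∈-applyUpTo⁻ (λ k → climb k s) u∈)
          ; lowestColour = zero-offset j s (Bottom.bottom b)
          ; highestColour = offset-last j (climb m s) (trans (cong suc (Climbed.offset≡ (climbed b m<n))) suc-m≡n) }
          where
          m = ℕ.pred n
          suc-m≡n : suc m ≡ n
          suc-m≡n = ℕ.suc-pred n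
          m<n : m ℕ.< n
          m<n = ℕ.≤-reflexive suc-m≡n
          is-lowest : ∀ {u} → ∃[ k ] k ℕ.< n × u ≡ climb k s → level s ≤ level u
          is-lowest (k , k<n , refl) = subst (level s ≤_) (sym (Climbed.level≡ (climbed b k<n))) (ℤ.i≤i+j (level s) (+ k))
          is-highest : ∀ {u} → ∃[ k ] k ℕ.< n × u ≡ climb k s → level u ≤ level (climb m s)
          is-highest (k , k<n , refl) = subst₂ _≤_ (sym (Climbed.level≡ (climbed b k<n))) (sym (Climbed.level≡ (climbed b m<n)))
            (ℤ.+-monoʳ-≤ (level s) (+≤+ (ℕ.≤-pred (subst (k ℕ.<_) (sym suc-m≡n) k<n))))

        column-up : ∀ {u} → u ∈ column s → colour n u ≢ j → up u ∈ column s
        column-up u∈ u≢j with ∈-applyUpTo⁻ (λ k → climb k s) u∈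
        ... | k , k<n , refl = column⁺ {suc k} (subst (λ i → suc i ℕ.< n) (Climbed.offset≡ (climbed b k<n)) (offset-≢ j (climb k s) u≢j))

        -- Adjacent squares of a column are thus consecutive in the climb, which `plain-uncrossed`
        -- uses to show that a column crosses marked edges only.
        column-level : ∀ {u w} → u ∈ column s → w ∈ column s → level w ≡ level u + 1ℤ → w ≡ up u × colour n u ≢ j
        column-level u∈ w∈ eq with ∈-applyUpTo⁻ (λ k → climb k s) u∈ | ∈-applyUpTo⁻ (λ k → climb k s) w∈
        ... | k , k<n , refl | l , l<n , refl with ℤ.+-injective (+-cancelˡ (level s) (+ l) (+ suc k)
                (trans (sym (Climbed.level≡ (climbed b l<n))) (trans eq (trans (cong (_+ 1ℤ) (Climbed.level≡ (climbed b k<n))) (sym (+suc (level s) k))))))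
        ...   | refl = refl , climbed≢ (climbed b k<n) l<n

      column-⊆ : ∀ {s u i j w} → Bottom s i → Bottom u j → w ∈ column s → w ∈ column u →
                 ∀ {x} → x ∈ column s → x ∈ column u
      column-⊆ {s} {u} {i} {j} {w} b b′ w∈s w∈u {x} = go (column⁻ b w∈s) (column⁻ b′ w∈u)
        where
        go : Typed w i × descend (offset i (level w)) w ≡ s × climb (offset i (level w)) s ≡ w →
             Typed w j × descend (offset j (level w)) w ≡ u × climb (offset j (level w)) u ≡ w →
             x ∈ column s → x ∈ column u
        go (τ , eq , _) (υ , eq′ , _) = subst (λ z → x ∈ column z) (trans (sym eq)
          (trans (cong (λ k → descend (offset k (level w)) w) (typed-unique τ υ)) eq′))

      record Column (s : Square) : Set where
        field
          {start} : Square
          {type}  : Fin n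
          bottom  : Bottom start type
          member  : s ∈ column start

        tile : Tile n
        tile = column-tile bottom

      columnAt : ∀ {s} → s ∈ R → Column s
      columnAt {s} s∈R = record
        { bottom = proj₁ d
        ; member = subst (_∈ column (descend (offset j (level s)) s)) (proj₂ d) (column⁺ (proj₁ d) (offset<n j (level s))) }
        where
        j = proj₁ (typeOf s∈R)
        d = descended (offset j (level s)) (proj₂ (typeOf s∈R)) refl

      tileAt : ∀ {s} → s ∈ R → Tile n
      tileAt s∈R = Column.tile (columnAt s∈R)

      tile⁻ : ∀ {t} → t ∈ₜ mapWith∈ R tileAt → ∃[ s ] Σ[ c ∈ Column s ] t ≈ₜ Column.tile c
      tile⁻ t∈ = let s , s∈R , t≈ = mapWith∈⁻ R tileAt t∈ in s , columnAt s∈R , t≈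

      tile⁺ : ∀ {s} (s∈R : s ∈ R) → tileAt s∈R ∈ₜ mapWith∈ R tileAt
      tile⁺ {s} s∈R = mapWith∈⁺ tileAt (s , s∈R , ≈ₜ-refl {tileAt s∈R})

      tiling : Tiling n R
      tiling = record
        -- Every entry of `R` contributes the column through it, so a tile is listed repeatedly;
        -- `disjoint` only asks overlapping tiles to be equivalent.
        { tiles = mapWith∈ R tileAt
        ; within = λ {t} t∈ s∈t → let _ , c , t⊆ , _ = tile⁻ {t} t∈ in
            Typed.member (proj₁ (column⁻ (Column.bottom c) (t⊆ s∈t)))
        ; covering = λ s∈R → tileAt s∈R , tile⁺ s∈R , Column.member (columnAt s∈R)
        ; disjoint = λ {t} {u} t∈ u∈ s∈t s∈u →
            let _ , c , t⊆ , ⊆t = tile⁻ {t} t∈ ; _ , d , u⊆ , ⊆u = tile⁻ {u} u∈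
                b = Column.bottom c ; b′ = Column.bottom d in
            (λ x∈t → ⊆u (column-⊆ b b′ (t⊆ s∈t) (u⊆ s∈u) (t⊆ x∈t))) ,
            (λ x∈u → ⊆t (column-⊆ b′ b (u⊆ s∈u) (t⊆ s∈t) (u⊆ x∈u)))
        }

      -- The upper square leaves only its south and west edges, and these have different lower
      -- squares.
      edge-determined : ∀ {e e′} → Ascending e → Ascending e′ → left e ≡ left e′ → right e ≡ right e′ → e ≡ e′
      edge-determined {e} {e′} asc asc′ l≡ r≡ = go (ascending-left asc)
        (subst (λ s → e′ ≡ southEdge s ⊎ e′ ≡ westEdge s) (sym l≡) (ascending-left asc′))
        where
        go : e ≡ southEdge (left e) ⊎ e ≡ westEdge (left e) → e′ ≡ southEdge (left e) ⊎ e′ ≡ westEdge (left e) → e ≡ e′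
        go (inj₁ p) (inj₁ q) = trans p (sym q)
        go (inj₂ p) (inj₂ q) = trans p (sym q)
        go (inj₁ p) (inj₂ q) = ⊥-elim (south≢west (left e) (trans (cong right (sym p)) (trans r≡ (cong right q))))
        go (inj₂ p) (inj₁ q) = ⊥-elim (south≢west (left e) (trans (cong right (sym q)) (trans (sym r≡) (cong right p))))

      module _ {e} (asc : Ascending e) where

        -- A tile with both sides of `e` is a column, where the upper side is `up` of the lower one.
        -- Then `e` is the corresponding `upEdge`, which is marked.
        plain-uncrossed : Plain e → ∀ {t} → t ∈ₜ mapWith∈ R tileAt → ¬ Crosses n e t
        plain-uncrossed plain {t} t∈ (l∈t , r∈t) = plain⇒¬marked plain (subst (λ e → Marked e (Column.type c)) same marked)
          where
          c : Column (proj₁ (tile⁻ {t} t∈))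
          c = proj₁ (proj₂ (tile⁻ {t} t∈))
          t⊆ : ∀ {s} → s ∈ squares t → s ∈ column (Column.start c)
          t⊆ = proj₁ (proj₂ (proj₂ (tile⁻ {t} t∈)))
          next-up : left e ≡ up (right e) × colour n (right e) ≢ Column.type c
          next-up = column-level (Column.bottom c) (t⊆ r∈t) (t⊆ l∈t) (level-ascending asc)
          marked : Marked (upEdge (right e)) (Column.type c)
          marked = upEdge-marked (proj₁ (column⁻ (Column.bottom c) (t⊆ r∈t))) (proj₂ next-up)
          same : upEdge (right e) ≡ e
          same = edge-determined {upEdge (right e)} {e} (upEdge-ascending (right e)) asc (sym (proj₁ next-up)) (right-upEdge (right e))

        increment-marked : ∀ {j} → Marked e j → increment tiling e ≡ crossed n j (colour n (right e))
        increment-marked {j} m = trans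
          (increment-crossed tiling {e} {Column.tile c} (tile⁺ (Marked.right∈R m)) (l∈ , Column.member c) (column-type (Column.bottom c)))
          (cong (λ i → crossed n i (colour n (right e))) i≡j)
          where
          c : Column (right e)
          c = columnAt (Marked.right∈R m)
          i≡j : Column.type c ≡ j
          i≡j = typed-unique (proj₁ (column⁻ (Column.bottom c) (Column.member c))) (proj₂ (marked-right asc m))
          l∈ : left e ∈ column (Column.start c)
          l∈ = subst (_∈ column (Column.start c)) (cong left (proj₁ (marked-right asc m)))
            (column-up (Column.bottom c) (Column.member c) λ eq → Marked.j≢ m (sym (trans eq i≡j)))

        increment-tiling : left e ∈ R ⊎ right e ∈ R → ∀ k → increment tiling e k ≡ g e k
        increment-tiling incident k = go (classify asc incident)
          where
          go : Plain e ⊎ ∃ (Marked e) → increment tiling e k ≡ g e k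
          go (inj₁ plain)   = trans (cong (λ v → v k) (increment-uncrossed tiling {e} λ {t} → plain-uncrossed plain {t})) (sym (plain k))
          go (inj₂ (j , m)) = trans (cong (λ v → v k) (increment-marked m)) (sym (Marked.value m k))

  -- Increments read off an admissible function

  module FromHeightFunction {R : List Square} {v₀ : Vertex R} (h : VertexFunction n R) (adm : Admissible n R v₀ h) where

    open FromIncrements {R = R} using (Plain; Marked)

    -- The endpoints of `e` become vertices only through a square of `R`; the left one is preferred.
    -- If both sides lie in `R`, the vertices seen from either side are the same. The value 0 away
    -- from `R` is a filler.
    increments : OrientedEdge → Vector ℤ n
    increments e k with left e ∈? R | right e ∈? R
    ... | yes l∈R | _       = (h ⟨$⟩ corner l∈R (head e) (head-left e)) k - (h ⟨$⟩ corner l∈R (tail e) (tail-left e)) k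
    ... | no _    | yes r∈R = (h ⟨$⟩ corner r∈R (head e) (head-right e)) k - (h ⟨$⟩ corner r∈R (tail e) (tail-right e)) k
    ... | no _    | no _    = 0ℤ

    difference-cong : ∀ {v v′ w w′} → SameVertex R v v′ → SameVertex R w w′ → ∀ k →
      (h ⟨$⟩ w) k - (h ⟨$⟩ v) k ≡ (h ⟨$⟩ w′) k - (h ⟨$⟩ v′) k
    difference-cong {v} {v′} {w} {w′} v~v′ w~w′ k =
      cong₂ _-_ (Func.cong h {w} {w′} w~w′ k) (Func.cong h {v} {v′} v~v′ k)

    increments-gradient : Gradient {R = R} h increments
    increments-gradient {e} {v} {w} _ record { sameSquare = s≡ ; incident = incident ; from = from ; to = to } k
      with left e ∈? R | right e ∈? R | incident
    ... | yes l∈R | _ | inj₁ s≡l = difference-cong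
      (sameVertex v (corner l∈R (tail e) (tail-left e)) s≡l from)
      (sameVertex w (corner l∈R (head e) (head-left e)) (trans (sym s≡) s≡l) to) k
    ... | yes l∈R | yes r∈R | inj₂ s≡r = trans
      (difference-cong
        (sameVertex v (corner r∈R (tail e) (tail-right e)) s≡r from)
        (sameVertex w (corner r∈R (head e) (head-right e)) (trans (sym s≡) s≡r) to) k)
      (sym (difference-cong
        {corner l∈R (tail e) (tail-left e)} {corner r∈R (tail e) (tail-right e)}
        {corner l∈R (head e) (head-left e)} {corner r∈R (head e) (head-right e)}
        (sameVertex-across e l∈R r∈R (tail-left e) (tail-right e))
        (sameVertex-across e l∈R r∈R (head-left e) (head-right e)) k))
    ... | no _ | yes r∈R | inj₂ s≡r = difference-cong
      (sameVertex v (corner r∈R (tail e) (tail-right e)) s≡r from)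
      (sameVertex w (corner r∈R (head e) (head-right e)) (trans (sym s≡) s≡r) to) k
    ... | yes _ | no r∉R | inj₂ s≡r = contradiction (subst (_∈ R) s≡r (square∈R v)) r∉R
    ... | no l∉R | _ | inj₁ s≡l = contradiction (subst (_∈ R) s≡l (square∈R v)) l∉R
    ... | no _ | no r∉R | inj₂ s≡r = contradiction (subst (_∈ R) s≡r (square∈R v)) r∉R

    -- Both sums telescope to the difference of `h` between the south-east and the north-west
    -- corner.
    increments-balanced : ∀ {s} → s ∈ R → Balanced {R = R} increments s
    increments-balanced {x , y} s∈R k = lem {(h ⟨$⟩ sw) k} {(h ⟨$⟩ se) k} {(h ⟨$⟩ nw) k} {(h ⟨$⟩ ne) k}
      (increments-gradient east edge-south k) (increments-gradient south edge-west k)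
      (increments-gradient east edge-north k) (increments-gradient south edge-east k)
      where
      open Corners s∈R
      rearrange : ∀ a b c d → b - a + (a - c) ≡ d - c + (b - d)
      rearrange = solve-∀
      lem : ∀ {a b c d p q r s} → b - a ≡ p → a - c ≡ q → d - c ≡ r → b - d ≡ s → p + q ≡ r + s
      lem {a} {b} {c} {d} refl refl refl refl = rearrange a b c d

    increments-classify : ∀ {e} → Ascending e → left e ∈ R ⊎ right e ∈ R → Plain increments e ⊎ ∃ (Marked increments e)
    increments-classify {e} asc incident = go (left e ∈? R) (right e ∈? R) incident
      where
      e-type = edgeOfType {n} asc
      edge-left : ∀ l∈R → EdgeFromTo R e (corner l∈R (tail e) (tail-left e)) (corner l∈R (head e) (head-left e))
      edge-left l∈R = record { sameSquare = refl ; incident = inj₁ refl ; from = refl ; to = refl }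
      edge-right : ∀ r∈R → EdgeFromTo R e (corner r∈R (tail e) (tail-right e)) (corner r∈R (head e) (head-right e))
      edge-right r∈R = record { sameSquare = refl ; incident = inj₂ refl ; from = refl ; to = refl }
      go : Dec (left e ∈ R) → Dec (right e ∈ R) → left e ∈ R ⊎ right e ∈ R → Plain increments e ⊎ ∃ (Marked increments e)
      go (yes l∈R) (no r∉R) _ = inj₁ λ k → trans (sym (increments-gradient asc (edge-left l∈R) k))
        (Admissible.boundary adm (edge-left l∈R) e-type (inj₁ (l∈R , r∉R)) k)
      go (no l∉R) (yes r∈R) _ = inj₁ λ k → trans (sym (increments-gradient asc (edge-right r∈R) k))
        (Admissible.boundary adm (edge-right r∈R) e-type (inj₂ (l∉R , r∈R)) k)
      go (no l∉R) (no r∉R) incident = ⊥-elim (Sum.[ l∉R , r∉R ]′ incident)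
      go (yes l∈R) (yes r∈R) _ with Admissible.interior adm (edge-left l∈R) e-type (l∈R , r∈R)
      ... | inj₁ plain = inj₁ λ k → trans (sym (increments-gradient asc (edge-left l∈R) k)) (plain k)
      ... | inj₂ (j , j≢ , value) = inj₂ (j , record
        { left∈R = l∈R ; right∈R = r∈R ; j≢ = j≢
        ; value = λ k → trans (sym (increments-gradient asc (edge-left l∈R) k)) (value k) })

    open FromIncrements.Construct {R = R} increments increments-balanced increments-classify using (tiling; increment-tiling) public

    tiling-gradient : Gradient {R = R} h (increment tiling)
    tiling-gradient {e} {v} asc edge k = trans (increments-gradient asc edge k)
      (sym (increment-tiling asc (Sum.map (λ eq → subst (_∈ R) eq (square∈R v)) (λ eq → subst (_∈ R) eq (square∈R v)) (EdgeFromTo.incident edge)) k))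

-- The bijection between tilings and admissible functions

mainTheorem5 : (n : ℕ) .{{_ : NonZero n}} (R : List Square) →
    Connected R → SimplyConnected R →
    (v₀ : Vertex R) → BoundaryVertex R v₀ →
    Σ[ H ∈ Bijection (tilingSetoid n R) (admissibleSetoid n R v₀) ]
    (∀ (α : Tiling n R) (h : VertexFunction n R) →
    IsHeightFunction n R v₀ α h ⇔
    Setoid._≈_ (vertexFunctions n R) h (proj₁ (Bijection.to H α)))
mainTheorem5 n R conn sconn v₀ _ = bijection , λ α h → mk⇔
  (λ hf → gradient-unique conn v₀ {increment α} {h} {height α} (heightFunction⇒gradient α hf) (∇height α)
    λ k → trans (IsHeightFunction.base hf k) (sym (height-base α k)))
  (λ h≈ → gradient⇒heightFunction α (λ k → trans (h≈ v₀ k) (height-base α k))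
    λ {_} {v} {w} asc edge k → trans (cong₂ _-_ (h≈ w k) (h≈ v k)) (∇height α asc edge k))
  where
  height : Tiling n R → VertexFunction n R
  height α = proj₁ (integrate conn v₀ sconn (increment α) (increment-balanced α))

  height-base : ∀ α k → (height α ⟨$⟩ v₀) k ≡ 0ℤ
  height-base α = proj₁ (proj₂ (integrate conn v₀ sconn (increment α) (increment-balanced α)))

  ∇height : ∀ α → Gradient (height α) (increment α)
  ∇height α = proj₂ (proj₂ (integrate conn v₀ sconn (increment α) (increment-balanced α)))

  -- Allowing `α` to be merely equivalent to `β` serves two ends: congruence of the map, and
  -- surjectivity, which asks about every tiling equivalent to the chosen preimage.
  height-unique : ∀ {α β} → Setoid._≈_ (tilingSetoid n R) α β → ∀ {h} → (∀ k → (h ⟨$⟩ v₀) k ≡ 0ℤ) →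
                  Gradient h (increment β) → Setoid._≈_ (vertexFunctions n R) (height α) h
  height-unique {α} {β} α≈β {h} base ∇h = gradient-unique conn v₀ {increment α} {height α} {h} (∇height α)
    (λ {e} asc edge k → trans (∇h asc edge k) (sym (cong (λ v → v k) (increment-cong α β α≈β e))))
    λ k → trans (height-base α k) (sym (base k))

  bijection : Bijection (tilingSetoid n R) (admissibleSetoid n R v₀)
  bijection = record
    { to = λ α → height α , gradient⇒admissible α (height-base α) (∇height α)
    ; cong = λ {α} {β} α≈β → height-unique {α} {β} α≈β {height β} (height-base β) (∇height β)
    ; bijective =
        (λ {α} {β} h≈ → gradient-injective α β {height α} {height β} (∇height α) (∇height β) h≈) ,
        λ (h , adm) → FromHeightFunction.tiling {v₀ = v₀} h adm ,
          λ {α} α≈ → height-unique {α} {FromHeightFunction.tiling {v₀ = v₀} h adm} α≈ {h} (Admissible.base adm)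
            (FromHeightFunction.tiling-gradient {v₀ = v₀} h adm)
    }
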